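{- Let $p$ be a prime, $n\ge 1$, and let $f_0,f_1,\ldots,f_{p-1}$ be near-bent functions from $\mathbb{F}_{p^n}$ to $\mathbb{F}_p$ such that $supp(\widehat{f_i})\cap supp(\widehat{f_j})=\emptyset$ for all $0\le i\ne j\le p-1$. Then the function $F:\mathbb{F}_{p^n}\times\mathbb{F}_p\to\mathbb{F}_p$ defined by \[ F(x,y)=(p-1)\sum_{k=0}^{p-1}\Big(\prod_{\substack{j=0\\ j\neq k}}^{p-1}(y-j)\Big)f_k(x) \] (i.e. $(p-1)\sum_{k}\frac{y(y-1)\cdots(y-(p-1))}{y-k}f_k(x)$) is bent.
   Context: $\epsilon_p=e^{2\pi i/p}$ and $\mathrm{Tr}_n$ is the absolute trace from $\mathbb{F}_{p^n}$ to $\mathbb{F}_p$. For $f:\mathbb{F}_{p^n}\to\mathbb{F}_p$, its Fourier (Walsh) transform is $\widehat{f}(b)=\sum_{x\in\mathbb{F}_{p^n}}\epsilon_p^{f(x)-\mathrm{Tr}_n(bx)}$, and $supp(\widehat f)=\{b:\widehat f(b)\neq 0\}$. $f$ is near-bent if $|\widehat f(b)|^2\in\{0,p^{n+1}\}$ for all $b$. For $F:\mathbb{F}_{p^n}\times\mathbb{F}_p\to\mathbb{F}_p$ the Fourier transform is $\widehat F(a,b)=\sum_{x\in\mathbb{F}_{p^n},y\in\mathbb{F}_p}\epsilon_p^{F(x,y)-\mathrm{Tr}_n(ax)-by}$, and $F$ is bent if $|\widehat F(a,b)|^2=p^{n+1}$ for all $(a,b)$. -}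

module Defs where

open import Level using (0ℓ)
open import Data.Nat as ℕ using (ℕ; zero; suc; NonZero)
open import Data.Fin as Fin using (Fin; toℕ; fromℕ<)
open import Data.Fin.Properties using () renaming (_≟_ to _≟F_)
open import Data.Integer as ℤ using (ℤ; +_; _%ℕ_)
open import Data.Integer.DivMod using (n%ℕd<d)
open import Data.Product using (Σ; _×_; _,_)
open import Data.Sum using (_⊎_)
open import Relation.Nullary using (¬_; yes; no)
open import Relation.Binary.PropositionalEquality using (_≡_; _≢_)
open import Algebra.Structures using (IsCommutativeRing)
open import Function.Bundles using (_↔_; Inverse)

record FiniteField (p n : ℕ) : Set₁ where
  field
    Carrier : Set
    _+_ _*_ : Carrier → Carrier → Carrier
    -_      : Carrier → Carrier
    0# 1#   : Carrier
    isCommutativeRing : IsCommutativeRing _≡_ _+_ _*_ -_ 0# 1#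
    0≢1     : 0# ≢ 1#
    inverse : ∀ x → x ≢ 0# → Σ Carrier (λ y → x * y ≡ 1#)
    enum    : Carrier ↔ Fin (p ℕ.^ n)

  infixl 6 _+_
  infixl 7 _*_

  _^_ : Carrier → ℕ → Carrier
  x ^ zero  = 1#
  x ^ suc k = x * (x ^ k)

  ι : ℕ → Carrier
  ι zero    = 0#
  ι (suc k) = 1# + ι k

  TrK : Carrier → Carrier
  TrK x = go n
    where
    go : ℕ → Carrier
    go zero    = 0#
    go (suc i) = x ^ (p ℕ.^ i) + go i

  -- identifying Tr_n(x) (which lies in the prime field) with an element
  -- of F_p = Fin p: the least k < p with k·1 = Tr_n(x)
  -- (such k always exists; the default 0 is never used).
  Tr : Carrier → ℕ
  Tr x = search p
    where
    search : ℕ → ℕ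
    search zero    = 0
    search (suc k) with Inverse.to enum (ι (p ℕ.∸ suc k)) ≟F Inverse.to enum (TrK x)
    ... | yes _ = p ℕ.∸ suc k
    ... | no  _ = search k

-- The ring Z[ε_p] (ε_p = e^{2πi/p}, p prime), in which all Fourier
-- coefficients live.  An element Σ_k c_k ε_p^k is represented by its
-- coefficient vector c : Fin p → ℤ; since the minimal polynomial of ε_p
-- is 1 + X + ... + X^{p-1}, two vectors denote the same complex number
-- iff their difference is a constant vector.

Cyc : ℕ → Set
Cyc p = Fin p → ℤ

module _ {p : ℕ} .{{_ : NonZero p}} where

  modp : ℤ → Fin p
  modp m = fromℕ< (n%ℕd<d m p)

  -- equality of the denoted complex numbers
  _≈_ : Cyc p → Cyc p → Set
  a ≈ b = ∀ i j → a i ℤ.- b i ≡ a j ℤ.- b j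

  ε : ℤ → Cyc p
  ε m i with toℕ i ℕ.≟ toℕ (modp m)
  ... | yes _ = + 1
  ... | no  _ = + 0

  const : ℤ → Cyc p
  const c = ε (+ 0) ⊛ c
    where
    _⊛_ : Cyc p → ℤ → Cyc p
    (a ⊛ c′) i = a i ℤ.* c′

  zeroC : Cyc p
  zeroC _ = + 0

  _⊕_ : Cyc p → Cyc p → Cyc p
  (a ⊕ b) i = a i ℤ.+ b i

  sumFin : (m : ℕ) → (Fin m → Cyc p) → Cyc p
  sumFin zero    h = zeroC
  sumFin (suc m) h = h Fin.zero ⊕ sumFin m (λ i → h (Fin.suc i))

  sumℤ : (m : ℕ) → (Fin m → ℤ) → ℤ
  sumℤ zero    h = + 0
  sumℤ (suc m) h = h Fin.zero ℤ.+ sumℤ m (λ i → h (Fin.suc i))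

  _⊗_ : Cyc p → Cyc p → Cyc p
  (a ⊗ b) k = sumℤ p (λ i → a i ℤ.* b (modp (+ toℕ k ℤ.- + toℕ i)))

  conj : Cyc p → Cyc p
  conj a k = a (modp (ℤ.- (+ toℕ k)))

  ∣_∣² : Cyc p → Cyc p
  ∣ z ∣² = z ⊗ conj z

module _ {p n : ℕ} .{{_ : NonZero p}} (K : FiniteField p n) where
  open FiniteField K

  sumK : (Carrier → Cyc p) → Cyc p
  sumK h = sumFin (p ℕ.^ n) (λ i → h (Inverse.from enum i))

  fourier : (Carrier → Fin p) → Carrier → Cyc p
  fourier f b = sumK (λ x → ε (+ toℕ (f x) ℤ.- + Tr (b * x)))

  inSupp : (Carrier → Fin p) → Carrier → Set
  inSupp f b = ¬ (fourier f b ≈ zeroC)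

  NearBent : (Carrier → Fin p) → Set
  NearBent f = ∀ b → (∣ fourier f b ∣² ≈ zeroC)
                   ⊎ (∣ fourier f b ∣² ≈ const (+ (p ℕ.^ suc n)))

  fourier₂ : (Carrier → Fin p → Fin p) → Carrier → Fin p → Cyc p
  fourier₂ F a b = sumK (λ x → sumFin p (λ y →
      ε (+ toℕ (F x y) ℤ.- + Tr (a * x) ℤ.- + toℕ b ℤ.* + toℕ y)))

  Bent : (Carrier → Fin p → Fin p) → Set
  Bent F = ∀ a b → ∣ fourier₂ F a b ∣² ≈ const (+ (p ℕ.^ suc n))

  gluedF : (Fin p → Carrier → Fin p) → Carrier → Fin p → Fin p
  gluedF f x y = modp ((+ (p ℕ.∸ 1)) ℤ.* sumℤ p (λ k →
      prodExcept k ℤ.* + toℕ (f k x)))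
    where
    prodℤ : (m : ℕ) → (Fin m → ℤ) → ℤ
    prodℤ zero    h = + 1
    prodℤ (suc m) h = h Fin.zero ℤ.* prodℤ m (λ i → h (Fin.suc i))
    prodExcept : Fin p → ℤ
    prodExcept k = prodℤ p (λ j → factor j)
      where
      factor : Fin p → ℤ
      factor j with toℕ j ℕ.≟ toℕ k
      ... | yes _ = + 1
      ... | no  _ = + toℕ y ℤ.- + toℕ j

{-# OPTIONS --safe #-}
module Submission where

open import Defs
open import Algebra.Bundles using (CommutativeMonoid; CommutativeRing)
import Algebra.Properties.CommutativeMonoid.Sum as CMSum
import Algebra.Properties.CommutativeSemiring.Binomial as Binomial
import Algebra.Properties.Ring as RingProperties
import Algebra.Properties.Semiring.Exp as SemiringExp
import Algebra.Properties.Semiring.Mult as SemiringMult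
import Algebra.Properties.Semiring.Sum as SemiringSum
import Algebra.Solver.Ring.NaturalCoefficients.Default as NaturalSolver
open import Data.Fin as Fin using (Fin; zero; suc; toℕ; fromℕ; punchIn)
open import Data.Fin.Permutation using (Permutation′; permutation)
import Data.Fin.Properties as Finₚ
open import Data.Integer as ℤ using (ℤ; +_; -[1+_])
open import Data.Integer.DivMod using (a≡a%ℕn+[a/ℕn]*n; n%ℕd<d)
import Data.Integer.Divisibility.Signed as ℤ∣
import Data.Integer.Properties as ℤₚ
open import Data.Integer.Tactic.RingSolver using (solve-∀)
open import Data.Nat as ℕ using (ℕ; zero; suc; NonZero; _≥_; _!)
open import Data.Nat.Combinatorics using (_C_; nCn≡1; nCk≡n!/k![n-k]!; k![n∸k]!∣n!)
open import Data.Nat.Coprimality using (prime⇒coprime; coprime-Bézout)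
open import Data.Nat.Divisibility as ℕ∣ using ()
open import Data.Nat.DivMod using (m≡m%n+[m/n]*n; m/n*n≡m)
open import Data.Nat.GCD using (module Bézout)
open import Data.Nat.Primality using (Prime; euclidsLemma; prime⇒nonTrivial; prime⇒nonZero)
import Data.Nat.Properties as ℕₚ
open import Data.Nat.Properties using (_!*_!≢0)
open import Data.Product using (∃; _×_; _,_; proj₁; proj₂)
import Data.Sign as Sign
open import Data.Sum using (_⊎_; inj₁; inj₂; [_,_]′)
open import Function using (_∘_; _$_; Inverse)
open import Level using (0ℓ)
open import Relation.Binary.PropositionalEquality
open import Relation.Nullary using (¬_; Dec; yes; no; contradiction)
open import Relation.Nullary.Decidable using (map′)

-- By Wilson's theorem the interpolation formula gives F(x,y) = f_y(x), so F̂(a,b) is the sum over y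
-- of ε^(−by) f̂_y(a). By Parseval's identity each near-bent f_y has exactly p^(n−1) points in the
-- support of its transform; as the p supports are disjoint, every a lies in exactly one of them, one
-- summand survives, and |F̂(a,b)|² = p^(n+1). Parseval's identity needs the characters ε^Tr(bx) to be
-- orthogonal: the trace is additive, is fixed by Frobenius and hence takes values in the prime field
-- (the roots of x^p − x), and is not identically 0, being a polynomial of degree p^(n−1) < p^n.

-- Elements of Z[ε_p] are available only as coefficient vectors modulo constant vectors, so the
-- analytic steps take a combinatorial form. A character sum is 0 when all its coefficients agree,
-- hence orthogonality becomes an equidistribution count. Near-bentness is a condition on |f̂|² but
-- the support is defined by f̂, so |z|² = 0 must imply z = 0; this rests on a sum of squares of
-- integers. An equation between integers inside Z[ε_p] is compared by subtracting the coefficient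
-- at 1 from the one at 0, which turns Parseval's identity into a count. Congruences that need an
-- idea are settled in K: the map from the integers to K has kernel pℤ, so Wilson's theorem and the
-- additivity of the trace become identities between field elements.

module SumSingle {c ℓ} (M : CommutativeMonoid c ℓ) where
  open CommutativeMonoid M using (Carrier; ∙-congˡ; identityʳ)
    renaming (_≈_ to _≋_; ε to 0ᴹ; trans to ≋-trans)
  open CMSum M

  sum-zero : ∀ {m} (t : Fin m → Carrier) → (∀ i → t i ≋ 0ᴹ) → sum t ≋ 0ᴹ
  sum-zero {m} t t≋0 = ≋-trans (sum-cong-≋ {m} t≋0) (sum-replicate-zero m)

  sum-single : ∀ {m} (t : Fin m → Carrier) i₀ → (∀ i → i ≢ i₀ → t i ≋ 0ᴹ) → sum t ≋ t i₀
  sum-single {suc m} t i₀ t≋0 =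
    ≋-trans (sum-remove {i = i₀} t)
      (≋-trans (∙-congˡ (sum-zero (t ∘ punchIn i₀) λ j → t≋0 _ (Finₚ.punchInᵢ≢i i₀ j)))
               (identityʳ _))

module Σℤ = CMSum ℤₚ.+-0-commutativeMonoid
module Σℕ = CMSum ℕₚ.+-0-commutativeMonoid
module ℤSum = SemiringSum ℤₚ.+-*-semiring
module ℕSum = SemiringSum ℕₚ.+-*-semiring

module IntegerSums where
  open import Data.Integer using (_+_; _*_; _-_; -_)
  open Σℤ
  open ℤSum using (*-distribˡ-sum; *-distribʳ-sum)

  sum-neg : ∀ {m} (t : Fin m → ℤ) → sum (λ i → - t i) ≡ - sum t
  sum-neg {zero}  t = refl
  sum-neg {suc m} t = trans (cong (λ w → - t zero + w) (sum-neg (t ∘ suc)))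
      (sym (ℤₚ.neg-distrib-+ (t zero) (sum (t ∘ suc))))

  ∑-distrib-minus : ∀ {m} (s t : Fin m → ℤ) → sum (λ i → s i - t i) ≡ sum s - sum t
  ∑-distrib-minus s t = trans (∑-distrib-+ s (-_ ∘ t)) (cong (λ w → sum s + w) (sum-neg t))

  sum*sum : ∀ {l m} (s : Fin l → ℤ) (t : Fin m → ℤ) → sum s * sum t
      ≡ sum (λ i → sum (λ j → s i * t j))
  sum*sum s t = trans (*-distribʳ-sum (sum t) s) (sum-cong-≗ λ i → *-distribˡ-sum (s i) t)

  i*i≥0 : ∀ i → + 0 ℤ.≤ i * i
  i*i≥0 (+ n)    = subst (+ 0 ℤ.≤_) (ℤₚ.pos-* n n) (ℤ.+≤+ ℕ.z≤n)
  i*i≥0 -[1+ n ] = ℤ.+≤+ ℕ.z≤n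

  i*i≡0⇒i≡0 : ∀ i → i * i ≡ + 0 → i ≡ + 0
  i*i≡0⇒i≡0 i eq with ℤₚ.i*j≡0⇒i≡0∨j≡0 i eq
  ... | inj₁ e = e
  ... | inj₂ e = e

  sum-nonneg : ∀ {m} (t : Fin m → ℤ) → (∀ i → + 0 ℤ.≤ t i) → + 0 ℤ.≤ sum t
  sum-nonneg {zero}  t _  = ℤₚ.≤-refl
  sum-nonneg {suc m} t t≥0 = ℤₚ.+-mono-≤ (t≥0 zero) (sum-nonneg (t ∘ suc) (t≥0 ∘ suc))

  sum≡0⇒≡0 : ∀ {m} (t : Fin m → ℤ) → (∀ i → + 0 ℤ.≤ t i) → sum t ≡ + 0 → ∀ i → t i ≡ + 0
  sum≡0⇒≡0 {suc m} t t≥0 eq i = ℤₚ.≤-antisym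
      (subst (t i ℤ.≤_) (trans (sym (sum-remove {i = i} t)) eq) t≤) (t≥0 i)
    where
    t≤ : t i ℤ.≤ t i + sum (t ∘ punchIn i)
    t≤ = subst (ℤ._≤ t i + sum (t ∘ punchIn i)) (ℤₚ.+-identityʳ (t i))
        (ℤₚ.+-monoʳ-≤ (t i) (sum-nonneg _ (λ j → t≥0 (punchIn i j))))

open IntegerSums

-- Congruence mod p, and squared absolute values in Z[ε_p].

module Cyclotomic (p : ℕ) .{{_ : NonZero p}} where
  open import Data.Integer using (_+_; _*_; _-_; -_; ∣_∣; _%ℕ_; _/ℕ_)
  open import Data.Integer.Divisibility.Signed using
      (_∣_; divides; _∣?_; ∣m⇒∣-m; ∣m∣n⇒∣m+n; ∣m⇒∣m*n; ∣n⇒∣m*n; ∣⇒∣ᵤ)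
  open Σℤ
  open ℤSum using (*-distribˡ-sum)
  open SumSingle ℤₚ.+-0-commutativeMonoid

  infix 4 _∼_ _∼?_
  -- A record rather than a synonym for `+ p ∣ a - b`: unification cannot recover a and b from a
  -- subtraction, but it can from the record type.
  record _∼_ (a b : ℤ) : Set where
    constructor congruent
    field divides-difference : + p ∣ a - b
  open _∼_

  private
    move : ∀ {a b} → a ≡ b → + p ∣ a → + p ∣ b
    move refl d = d

  ∼-reflexive : ∀ {a b} → a ≡ b → a ∼ b
  ∼-reflexive {a} refl = congruent (move (sym (ℤₚ.+-inverseʳ a)) (divides (+ 0) refl))

  ∼-refl : ∀ {a} → a ∼ a
  ∼-refl = ∼-reflexive refl

  ∼-sym : ∀ {a b} → a ∼ b → b ∼ a
  ∼-sym {a} {b} (congruent d) = congruent $ move (l a b) (∣m⇒∣-m d)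
    where
    l : ∀ a b → - (a - b) ≡ b - a
    l = solve-∀

  ∼-trans : ∀ {a b c} → a ∼ b → b ∼ c → a ∼ c
  ∼-trans {a} {b} {c} (congruent d) (congruent e) = congruent $ move (l a b c) (∣m∣n⇒∣m+n d e)
    where
    l : ∀ a b c → (a - b) + (b - c) ≡ a - c
    l = solve-∀

  +-cong-∼ : ∀ {a b c d} → a ∼ b → c ∼ d → a + c ∼ b + d
  +-cong-∼ {a} {b} {c} {d} (congruent e) (congruent f) = congruent $ move (l a b c d)
      (∣m∣n⇒∣m+n e f)
    where
    l : ∀ a b c d → (a - b) + (c - d) ≡ (a + c) - (b + d)
    l = solve-∀

  neg-cong-∼ : ∀ {a b} → a ∼ b → - a ∼ - b
  neg-cong-∼ {a} {b} (congruent e) = congruent $ move (l a b) (∣m⇒∣-m e)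
    where
    l : ∀ a b → - (a - b) ≡ - a - - b
    l = solve-∀

  minus-cong-∼ : ∀ {a b c d} → a ∼ b → c ∼ d → a - c ∼ b - d
  minus-cong-∼ e f = +-cong-∼ e (neg-cong-∼ f)

  *-cong-∼ : ∀ {a b c d} → a ∼ b → c ∼ d → a * c ∼ b * d
  *-cong-∼ {a} {b} {c} {d} (congruent e) (congruent f) = congruent $ move (l a b c d)
      (∣m∣n⇒∣m+n (∣m⇒∣m*n c e) (∣n⇒∣m*n b f))
    where
    l : ∀ a b c d → (a - b) * c + b * (c - d) ≡ a * c - b * d
    l = solve-∀

  minus∼0 : ∀ {a b} → a ∼ b → a - b ∼ + 0
  minus∼0 (congruent e) = congruent $ move (sym (ℤₚ.+-identityʳ _)) e

  minus∼0⁻¹ : ∀ {a b} → a - b ∼ + 0 → a ∼ b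
  minus∼0⁻¹ (congruent e) = congruent $ move (ℤₚ.+-identityʳ _) e

  modp-∼ : ∀ a → + toℕ (modp {p} a) ∼ a
  modp-∼ a = ∼-sym (congruent $ divides (a /ℕ p)
        (trans (cong₂ _-_ (a≡a%ℕn+[a/ℕn]*n a p) (cong +_ (Finₚ.toℕ-fromℕ< (n%ℕd<d a p))))
          (l (+ (a %ℕ p)) _)))
    where
    l : ∀ a b → (a + b) - a ≡ b
    l = solve-∀

  ∼⇒≡ : ∀ {i j : Fin p} → + toℕ i ∼ + toℕ j → i ≡ j
  ∼⇒≡ {i} {j} (congruent d) = Finₚ.toℕ-injective
      (ℤₚ.+-injective (ℤₚ.i-j≡0⇒i≡j (+ toℕ i) (+ toℕ j) (ℤₚ.∣i∣≡0⇒i≡0 ∣∣≡0)))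
    where
    ∣∣<p : ∣ + toℕ i - + toℕ j ∣ ℕ.< p
    ∣∣<p = subst (ℕ._< p) (cong ∣_∣ (sym (ℤₚ.m-n≡m⊖n (toℕ i) (toℕ j))))
             (ℕₚ.≤-<-trans (ℤₚ.∣m⊝n∣≤m⊔n (toℕ i) (toℕ j))
                   (ℕₚ.⊔-pres-<m (Finₚ.toℕ<n i) (Finₚ.toℕ<n j)))
    ∣∣≡0 : ∣ + toℕ i - + toℕ j ∣ ≡ 0
    ∣∣≡0 with ∣ + toℕ i - + toℕ j ∣ | ∣∣<p | ∣⇒∣ᵤ d
    ... | zero  | _  | _  = refl
    ... | suc _ | lt | pd = contradiction (ℕ∣.∣⇒≤ pd) (ℕₚ.<⇒≱ lt)

  modp-cong : ∀ {a b} → a ∼ b → modp {p} a ≡ modp b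
  modp-cong {a} {b} e = ∼⇒≡ (∼-trans (modp-∼ a) (∼-trans e (∼-sym (modp-∼ b))))

  modp-toℕ : ∀ i → modp {p} (+ toℕ i) ≡ i
  modp-toℕ i = ∼⇒≡ (modp-∼ (+ toℕ i))

  _∼?_ : ∀ a b → Dec (a ∼ b)
  a ∼? b = map′ congruent divides-difference (+ p ∣? a - b)

  ε-yes : ∀ {m} {i : Fin p} → + toℕ i ∼ m → ε m i ≡ + 1
  ε-yes {m} {i} e with toℕ i ℕ.≟ toℕ (modp {p} m)
  ... | yes _ = refl
  ... | no ne = contradiction (cong toℕ (trans (sym (modp-toℕ i)) (modp-cong e))) ne

  ε-no : ∀ {m} {i : Fin p} → ¬ (+ toℕ i ∼ m) → ε m i ≡ + 0
  ε-no {m} {i} ne with toℕ i ℕ.≟ toℕ (modp {p} m)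
  ... | yes e = contradiction (∼-trans (∼-reflexive (cong +_ e)) (modp-∼ m)) ne
  ... | no _ = refl

  -- The indicator of p ∣ c, as a function on all of ℤ, so that coefficients of powers of ε can be
  -- shifted by integer arithmetic.
  ind : ℤ → ℤ
  ind c = ε {p} (+ 0) (modp c)

  ind-cong : ∀ {a b} → a ∼ b → ind a ≡ ind b
  ind-cong e = cong (ε (+ 0)) (modp-cong e)

  ind-yes : ∀ {a} → a ∼ + 0 → ind a ≡ + 1
  ind-yes {a} e = ε-yes (∼-trans (modp-∼ a) e)

  ind-no : ∀ {a} → ¬ (a ∼ + 0) → ind a ≡ + 0
  ind-no {a} ne = ε-no λ e → ne (∼-trans (∼-sym (modp-∼ a)) e)

  ε≡ind : ∀ m i → ε {p} m i ≡ ind (+ toℕ i - m)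
  ε≡ind m i with (+ toℕ i) ∼? m
  ... | yes e = trans (ε-yes e) (sym (ind-yes (minus∼0 e)))
  ... | no ne = trans (ε-no ne) (sym (ind-no λ e → ne (minus∼0⁻¹ e)))

  sumℤ≡sum : ∀ m (h : Fin m → ℤ) → sumℤ {p} m h ≡ sum h
  sumℤ≡sum zero    h = refl
  sumℤ≡sum (suc m) h = cong (λ w → h zero + w) (sumℤ≡sum m (h ∘ suc))

  sumFin≡sum : ∀ m (h : Fin m → Cyc p) i → sumFin m h i ≡ sum (λ x → h x i)
  sumFin≡sum zero    h i = refl
  sumFin≡sum (suc m) h i = cong (λ w → h zero i + w) (sumFin≡sum m (h ∘ suc) i)

  infixl 9 _⟨_⟩
  -- Integer indices read mod p keep index arithmetic in ℤ, where the ring solver applies.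
  _⟨_⟩ : Cyc p → ℤ → ℤ
  z ⟨ m ⟩ = z (modp m)

  ∑ε⟨⟩ : ∀ {m} (g : Fin m → ℤ) c → sumFin m (λ x → ε (g x)) ⟨ c ⟩ ≡ sum (λ x → ind (c - g x))
  ∑ε⟨⟩ {m} g c = trans (sumFin≡sum m (λ x → ε (g x)) (modp c))
      (sum-cong-≗ λ x → trans (ε≡ind (g x) (modp c)) (ind-cong (minus-cong-∼ (modp-∼ c) ∼-refl)))

  shift : ℤ → Permutation′ p
  shift s = permutation (λ i → modp (+ toℕ i + s)) (λ i → modp (+ toℕ i - s))
    (λ i → back (+ toℕ i - s) s i (l₁ (+ toℕ i) s))
        (λ i → back (+ toℕ i + s) (- s) i (l₂ (+ toℕ i) s))
    where
    l₁ : ∀ a s → a - s + s ≡ a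
    l₁ = solve-∀
    l₂ : ∀ a s → a + s + - s ≡ a
    l₂ = solve-∀
    back : ∀ a s i → a + s ≡ + toℕ i → modp {p} (+ toℕ (modp {p} a) + s) ≡ i
    back a s i e = trans (modp-cong (∼-trans (+-cong-∼ (modp-∼ a) ∼-refl) (∼-reflexive e)))
        (modp-toℕ i)

  sum-shift : ∀ (g : ℤ → ℤ) → (∀ {a b} → a ∼ b → g a ≡ g b) → ∀ s → sum {p} (λ i → g (+ toℕ i + s))
      ≡ sum {p} (λ i → g (+ toℕ i))
  sum-shift g g-cong s = trans (sum-cong-≗ {p} λ i → g-cong (∼-sym (modp-∼ (+ toℕ i + s))))
      (sym (sum-permute (λ i → g (+ toℕ i)) (shift s)))

  ⟨⟩-cong : ∀ (z : Cyc p) {a b} → a ∼ b → z ⟨ a ⟩ ≡ z ⟨ b ⟩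
  ⟨⟩-cong z e = cong z (modp-cong e)

  -- `conj` reverses the indices, which turns the convolution `z ⊗ conj z` into the cyclic
  -- autocorrelation of the coefficients.
  ∣∣²≡correlation : ∀ (z : Cyc p) k → ∣ z ∣² k
      ≡ sum {p} (λ i → z ⟨ + toℕ i ⟩ * z ⟨ + toℕ i - + toℕ k ⟩)
  ∣∣²≡correlation z k = trans (sumℤ≡sum p _)
      (sum-cong-≗ {p} λ i → cong₂ (λ a b → z a * z b) (sym (modp-toℕ i))
     (modp-cong (∼-trans (neg-cong-∼ (modp-∼ _)) (∼-reflexive (l (+ toℕ k) (+ toℕ i))))))
    where
    l : ∀ k i → - (k - i) ≡ i - k
    l = solve-∀

  variation : Cyc p → ℤ → ℤ
  variation z k = sum {p} (λ i → (z ⟨ + toℕ i ⟩ - z ⟨ + toℕ i - k ⟩) *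
        (z ⟨ + toℕ i ⟩ - z ⟨ + toℕ i - k ⟩))

  0F : Fin p
  0F = modp (+ 0)

  ∣∣²-0 : ∀ z → ∣ z ∣² 0F ≡ sum {p} (λ i → z ⟨ + toℕ i ⟩ * z ⟨ + toℕ i ⟩)
  ∣∣²-0 z = trans (∣∣²≡correlation z 0F)
      (sum-cong-≗ {p} λ i → cong (z ⟨ + toℕ i ⟩ *_)
        (⟨⟩-cong z (∼-trans (minus-cong-∼ {+ toℕ i} ∼-refl (modp-∼ (+ 0)))
            (∼-reflexive (ℤₚ.+-identityʳ (+ toℕ i))))))

  -- The left-hand side is manifestly unchanged when a constant vector is added to z, so |z|² is
  -- well defined up to _≈_, and its vanishing forces z to be constant.
  variation≡ : ∀ z k → variation z (+ toℕ k) ≡ + 2 * (∣ z ∣² 0F - ∣ z ∣² k)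
  variation≡ z k = begin
    variation z (+ toℕ k)
      ≡⟨ sum-cong-≗ {p} (λ i → l (z ⟨ + toℕ i ⟩) (z ⟨ + toℕ i - + toℕ k ⟩)) ⟩
    sum {p} (λ i → (s i + s′ i) - + 2 * c i)
      ≡⟨ ∑-distrib-minus {p} (λ i → s i + s′ i) (λ i → + 2 * c i) ⟩
    sum {p} (λ i → s i + s′ i) - sum {p} (λ i → + 2 * c i)
      ≡⟨ cong₂ _-_ (∑-distrib-+ s s′) (sym (*-distribˡ-sum (+ 2) c)) ⟩
    (sum s + sum s′) - + 2 * sum c
      ≡⟨ cong (λ w → (sum s + w) - + 2 * sum c)
          (sum-shift (λ a → z ⟨ a ⟩ * z ⟨ a ⟩) (λ e → cong₂ _*_ (⟨⟩-cong z e) (⟨⟩-cong z e))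
            (- (+ toℕ k))) ⟩
    (sum s + sum s) - + 2 * sum c
      ≡⟨ l₂ (sum s) (sum c) ⟩
    + 2 * (sum s - sum c)
      ≡⟨ cong₂ (λ a b → + 2 * (a - b)) (sym (∣∣²-0 z)) (sym (∣∣²≡correlation z k)) ⟩
    + 2 * (∣ z ∣² 0F - ∣ z ∣² k) ∎
    where
    open ≡-Reasoning
    s s′ c : Fin p → ℤ
    s i = z ⟨ + toℕ i ⟩ * z ⟨ + toℕ i ⟩
    s′ i = z ⟨ + toℕ i - + toℕ k ⟩ * z ⟨ + toℕ i - + toℕ k ⟩
    c i = z ⟨ + toℕ i ⟩ * z ⟨ + toℕ i - + toℕ k ⟩
    l : ∀ a b → (a - b) * (a - b) ≡ (a * a + b * b) - + 2 * (a * b)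
    l = solve-∀
    l₂ : ∀ a b → (a + a) - + 2 * b ≡ + 2 * (a - b)
    l₂ = solve-∀

  ≈-trans : (a b c : Cyc p) → a ≈ b → b ≈ c → a ≈ c
  ≈-trans a b c e f i j = trans (sym (l (a i) (b i) (c i)))
      (trans (cong₂ _+_ (e i j) (f i j)) (l (a j) (b j) (c j)))
    where
    l : ∀ a b c → (a - b) + (b - c) ≡ a - c
    l = solve-∀

  ≈⇒differences : (a b : Cyc p) → a ≈ b → ∀ i j → a i - a j ≡ b i - b j
  ≈⇒differences a b e i j = trans (l (a i) (a j) (b i) (b j))
      (trans (cong (λ w → (b i - b j) + (w - (a j - b j))) (e i j)) (l₂ (b i - b j) (a j - b j)))
    where
    l : ∀ a a′ b b′ → a - a′ ≡ (b - b′) + ((a - b) - (a′ - b′))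
    l = solve-∀
    l₂ : ∀ a b → a + (b - b) ≡ a
    l₂ = solve-∀

  0-differences⇒≈ : (a b : Cyc p) → (∀ k → a 0F - a k ≡ b 0F - b k) → a ≈ b
  0-differences⇒≈ a b e i j = trans (h i) (sym (h j))
    where
    l : ∀ a a′ b b′ → a - b ≡ (a′ - b′) - ((a′ - a) - (b′ - b))
    l = solve-∀
    l₂ : ∀ a b → a - (b - b) ≡ a
    l₂ = solve-∀
    h : ∀ i → a i - b i ≡ a 0F - b 0F
    h i = trans (l (a i) (a 0F) (b i) (b 0F))
        (trans (cong (λ w → (a 0F - b 0F) - (w - (b 0F - b i))) (e i))
          (l₂ (a 0F - b 0F) (b 0F - b i)))

  -- The variation is a sum of integer squares, so its vanishing makes every term vanish: z equals
  -- each of its cyclic shifts.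
  ∣∣²≈0⇒≈0 : (z : Cyc p) → ∣ z ∣² ≈ zeroC → z ≈ zeroC
  ∣∣²≈0⇒≈0 z e = 0-differences⇒≈ z zeroC λ k → trans (cong (_- z k) (h k)) (ℤₚ.+-inverseʳ (z k))
    where
    variation≡0 : ∀ k → variation z (+ toℕ k) ≡ + 0
    variation≡0 k = trans (variation≡ z k) (cong (+ 2 *_) (≈⇒differences ∣ z ∣² zeroC e 0F k))
    step : ∀ k i → z ⟨ + toℕ i ⟩ ≡ z ⟨ + toℕ i - + toℕ k ⟩
    step k i = ℤₚ.i-j≡0⇒i≡j _ _ (i*i≡0⇒i≡0 (d i)
          (sum≡0⇒≡0 (λ i → d i * d i) (λ i → i*i≥0 (d i)) (variation≡0 k) i))
      where
      d : Fin p → ℤ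
      d i = z ⟨ + toℕ i ⟩ - z ⟨ + toℕ i - + toℕ k ⟩
    h : ∀ k → z 0F ≡ z k
    h k = trans (cong z (modp-cong (∼-reflexive (sym (ℤₚ.+-inverseʳ (+ toℕ k))))))
        (trans (sym (step k k)) (cong z (modp-toℕ k)))

  -- The hypothesis says w = ε^(-s) z, and a root of unity has absolute value 1. It constrains only
  -- differences of coefficients, since vectors matter up to a constant; the case s = 0 makes |z|²
  -- depend only on the class of z.
  ∣∣²-shift : ∀ (z w : Cyc p) s → (∀ a b → w ⟨ a ⟩ - w ⟨ b ⟩ ≡ z ⟨ a + s ⟩ - z ⟨ b + s ⟩) →
      ∣ w ∣² ≈ ∣ z ∣²
  ∣∣²-shift z w s e = 0-differences⇒≈ ∣ w ∣² ∣ z ∣² λ k → ℤₚ.*-cancelˡ-≡ (+ 2) _ _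
      (trans (sym (variation≡ w k)) (trans (variation-shift (+ toℕ k)) (variation≡ z k)))
    where
    sq : ℤ → ℤ → ℤ
    sq k a = (z ⟨ a ⟩ - z ⟨ a - k ⟩) * (z ⟨ a ⟩ - z ⟨ a - k ⟩)
    sq-cong : ∀ k {a b} → a ∼ b → sq k a ≡ sq k b
    sq-cong k e = cong₂ (λ u v → (u - v) * (u - v)) (⟨⟩-cong z e)
        (⟨⟩-cong z (minus-cong-∼ e ∼-refl))
    l : ∀ a k s → a - k + s ≡ a + s - k
    l = solve-∀
    variation-shift : ∀ k → variation w k ≡ variation z k
    variation-shift k = trans (sum-cong-≗ {p} λ i → cong (λ u → u * u)
          (trans (e (+ toℕ i) (+ toℕ i - k))
            (cong (λ u → z ⟨ + toℕ i + s ⟩ - z ⟨ u ⟩) (l (+ toℕ i) k s))))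
                  (sum-shift (sq k) (sq-cong k) s)

  -- The coefficient at k of the expansion of |Σ ε^g(x)|² into Σ ε^(g(x) - g(y)), valid for the
  -- vectors themselves and not just up to constants.
  ∣∑ε∣² : ∀ {m} (g : Fin m → ℤ) k → ∣ sumFin m (λ x → ε (g x)) ∣² k
      ≡ sum (λ x → sum (λ y → ind (g x - g y - + toℕ k)))
  ∣∑ε∣² {m} g k = begin
    ∣ z ∣² k
      ≡⟨ ∣∣²≡correlation z k ⟩
    sum {p} (λ i → z ⟨ + toℕ i ⟩ * z ⟨ + toℕ i - + toℕ k ⟩)
      ≡⟨ sum-cong-≗ {p} (λ i → trans (cong₂ _*_ (∑ε⟨⟩ g (+ toℕ i)) (∑ε⟨⟩ g (+ toℕ i - + toℕ k)))
           (sum*sum (λ x → ind (+ toℕ i - g x)) (λ y → ind (+ toℕ i - + toℕ k - g y)))) ⟩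
    sum {p} (λ i → sum (λ x → sum (λ y → t i x y)))
      ≡⟨ ∑-comm {p} {m} (λ i x → sum (t i x)) ⟩
    sum (λ x → sum {p} (λ i → sum (λ y → t i x y)))
      ≡⟨ sum-cong-≗ (λ x → ∑-comm {p} {m} (λ i y → t i x y)) ⟩
    sum (λ x → sum (λ y → sum {p} (λ i → t i x y)))
      ≡⟨ sum-cong-≗ (λ x → sum-cong-≗ λ y → single x y) ⟩
    sum (λ x → sum (λ y → ind (g x - g y - + toℕ k))) ∎
    where
    open ≡-Reasoning
    z = sumFin m (λ x → ε (g x))
    t : Fin p → Fin m → Fin m → ℤ
    t i x y = ind (+ toℕ i - g x) * ind (+ toℕ i - + toℕ k - g y)
    l : ∀ a k b → a - k - b ≡ a - b - k
    l = solve-∀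
    single : ∀ x y → sum {p} (λ i → t i x y) ≡ ind (g x - g y - + toℕ k)
    single x y = trans
      (sum-single (λ i → t i x y) (modp (g x)) λ i ne →
        cong (_* ind (+ toℕ i - + toℕ k - g y))
            (ind-no {+ toℕ i - g x} λ e → ne (trans (sym (modp-toℕ i))
                (modp-cong (minus∼0⁻¹ {+ toℕ i} {g x} e)))))
      (trans (cong₂ _*_ (ind-yes (minus∼0 (modp-∼ (g x))))
              (ind-cong (∼-trans (minus-cong-∼ (minus-cong-∼ (modp-∼ (g x)) ∼-refl) ∼-refl)
                  (∼-reflexive (l (g x) (+ toℕ k) (g y))))))
             (ℤₚ.*-identityˡ _))

  ∣∣²-≈0 : ∀ (z : Cyc p) → z ≈ zeroC → ∣ z ∣² ≈ zeroC
  ∣∣²-≈0 z z≈0 = ≈-trans ∣ z ∣² ∣ zeroC ∣² zeroC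
    (∣∣²-shift zeroC z (+ 0) λ a b → ≈⇒differences z zeroC z≈0 (modp a) (modp b))
    (0-differences⇒≈ ∣ zeroC ∣² zeroC λ k → cong₂ _-_ (zero-∣∣² 0F) (zero-∣∣² k))
    where
    zero-∣∣² : ∀ k → ∣ zeroC {p} ∣² k ≡ + 0
    zero-∣∣² k = trans (sumℤ≡sum p _) (sum-zero {p} _ λ i → refl)

-- Divisibility of binomial coefficients by a prime.

prime∤! : ∀ {p} → Prime p → ∀ m → m ℕ.< p → ¬ (p ℕ∣.∣ m !)
prime∤! pr zero    m<p p∣ = contradiction (ℕ∣.∣⇒≤ p∣)
    (ℕₚ.<⇒≱ (ℕ.nonTrivial⇒n>1 _ {{prime⇒nonTrivial pr}}))
prime∤! pr (suc m) m<p p∣ with euclidsLemma (suc m) (m !) pr p∣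
... | inj₁ d = contradiction (ℕ∣.∣⇒≤ d) (ℕₚ.<⇒≱ m<p)
... | inj₂ d = prime∤! pr m (ℕₚ.<-trans (ℕₚ.n<1+n m) m<p) d

n∣n! : ∀ n .{{_ : NonZero n}} → n ℕ∣.∣ n !
n∣n! (suc n) = ℕ∣.divides (n !) (ℕₚ.*-comm (suc n) (n !))

-- p divides p! = C(p,k) · k! (p-k)!, but neither of the two factorials.
prime∣C : ∀ {p} → Prime p → ∀ k .{{_ : NonZero k}} → k ℕ.< p → p ℕ∣.∣ p C k
prime∣C {p} pr k k<p with euclidsLemma (p C k) (k ! ℕ.* (p ℕ.∸ k) !) pr
    (subst (p ℕ∣.∣_) (sym (trans (cong (ℕ._* d) (nCk≡n!/k![n-k]! (ℕₚ.<⇒≤ k<p)))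
              (m/n*n≡m {{k !* (p ℕ.∸ k) !≢0}} (k![n∸k]!∣n! (ℕₚ.<⇒≤ k<p)))))
          (n∣n! p {{prime⇒nonZero pr}}))
  where d = k ! ℕ.* (p ℕ.∸ k) !
... | inj₁ p∣C = p∣C
... | inj₂ p∣d with euclidsLemma (k !) ((p ℕ.∸ k) !) pr p∣d
... | inj₁ e = contradiction e (prime∤! pr k k<p)
... | inj₂ e = contradiction e (prime∤! pr (p ℕ.∸ k)
      (ℕₚ.∸-monoʳ-< (ℕₚ.n≢0⇒n>0 (ℕ.≢-nonZero⁻¹ k)) (ℕₚ.<⇒≤ k<p)))

-- Arithmetic of K: characteristic, prime field, Frobenius map.

module FieldTheory {p n : ℕ} .{{_ : NonZero p}} (pr : Prime p) (K : FiniteField p n) where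
  open FiniteField K
  open Cyclotomic p

  R : CommutativeRing 0ℓ 0ℓ
  R = record { isCommutativeRing = isCommutativeRing }

  open CommutativeRing R public using
      (_-_; +-assoc; +-comm; +-identityˡ; +-identityʳ; -‿inverseʳ; -‿inverseˡ; *-assoc; *-comm;
        *-identityˡ; *-identityʳ; distribˡ; distribʳ; zeroˡ; zeroʳ; +-commutativeMonoid;
        *-commutativeMonoid; commutativeSemiring; semiring; ring)
  open RingProperties ring public using
      (+-cancelˡ; +-cancelʳ; -‿distribˡ-*; x∙y⁻¹≈ε⇒x≈y; -‿involutive; -0#≈0#; +-inverseˡ-unique)

  module ΣK = CMSum +-commutativeMonoid
  module ΠK = CMSum *-commutativeMonoid
  module ×K = SemiringMult semiring
  module ^K = SemiringExp semiring

  q : ℕ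
  q = p ℕ.^ n

  element : Fin q → Carrier
  element = Inverse.from enum

  index : Carrier → Fin q
  index = Inverse.to enum

  element-index : ∀ x → element (index x) ≡ x
  element-index x = Inverse.inverseʳ enum refl

  index-element : ∀ i → index (element i) ≡ i
  index-element i = Inverse.inverseˡ enum refl

  index-injective : ∀ {x y} → index x ≡ index y → x ≡ y
  index-injective {x} {y} e = trans (sym (element-index x))
      (trans (cong element e) (element-index y))

  element-injective : ∀ {i j} → element i ≡ element j → i ≡ j
  element-injective {i} {j} e = trans (sym (index-element i))
      (trans (cong index e) (index-element j))

  infix 4 _≟_
  _≟_ : (x y : Carrier) → Dec (x ≡ y)
  x ≟ y = map′ index-injective (cong index) (index x Finₚ.≟ index y)

  bijection : (f g : Carrier → Carrier) → (∀ x → f (g x) ≡ x) → (∀ x → g (f x) ≡ x) → Permutation′ q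
  bijection f g fg gf = permutation (index ∘ f ∘ element) (index ∘ g ∘ element) (inv f g fg)
      (inv g f gf)
    where
    inv : ∀ f g → (∀ x → f (g x) ≡ x) → ∀ i → index (f (element (index (g (element i))))) ≡ i
    inv f g fg i = trans (cong (index ∘ f) (element-index _))
        (trans (cong index (fg (element i))) (index-element i))

  module Reindex (M : CommutativeMonoid 0ℓ 0ℓ) where
    open CommutativeMonoid M using () renaming
        (Carrier to A; _≈_ to _≋_; trans to ≋-trans; reflexive to ≋-reflexive)
    open CMSum M

    sum-bijection : (t : Carrier → A) (f g : Carrier → Carrier) → (∀ x → f (g x) ≡ x) →
        (∀ x → g (f x) ≡ x) →
      sum (t ∘ element) ≋ sum (t ∘ f ∘ element)
    sum-bijection t f g fg gf = ≋-trans (sum-permute (t ∘ element) (bijection f g fg gf))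
        (≋-reflexive (sum-cong-≗ {q} λ i → cong t (element-index _)))

  x*y≡0 : ∀ {x y} → x * y ≡ 0# → x ≡ 0# ⊎ y ≡ 0#
  x*y≡0 {x} {y} xy≡0 with x ≟ 0#
  ... | yes e = inj₁ e
  ... | no x≢0 with inverse x x≢0
  ... | z , xz≡1 = inj₂ (begin
    y           ≡⟨ sym (*-identityˡ y) ⟩
    1# * y      ≡⟨ cong (_* y) (trans (sym xz≡1) (*-comm x z)) ⟩
    z * x * y   ≡⟨ *-assoc z x y ⟩
    z * (x * y) ≡⟨ cong (z *_) xy≡0 ⟩
    z * 0#      ≡⟨ zeroʳ z ⟩
    0#          ∎)
    where open ≡-Reasoning

  *-cancelʳ : ∀ x y z → z ≢ 0# → x * z ≡ y * z → x ≡ y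
  *-cancelʳ x y z z≢0 e with inverse z z≢0
  ... | w , zw≡1 = trans (sym (h x)) (trans (cong (_* w) e) (h y))
    where
    h : ∀ x → x * z * w ≡ x
    h x = trans (*-assoc x z w) (trans (cong (x *_) zw≡1) (*-identityʳ x))

  ^-zero : ∀ x k → x ^ k ≡ 0# → x ≡ 0#
  ^-zero x zero    e = contradiction (sym e) 0≢1
  ^-zero x (suc k) e = [ (λ e → e) , ^-zero x k ]′ (x*y≡0 e)

  ^≡ : ∀ x k → x ^ k ≡ x ^K.^ k
  ^≡ x zero    = refl
  ^≡ x (suc k) = cong (x *_) (^≡ x k)

  ^-* : ∀ x k l → (x ^ k) ^ l ≡ x ^ (k ℕ.* l)
  ^-* x k l = trans (trans (^≡ (x ^ k) l) (cong (^K._^ l) (^≡ x k)))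
      (trans (^K.^-assocʳ x k l) (sym (^≡ x (k ℕ.* l))))

  1^ : ∀ k → 1# ^ k ≡ 1#
  1^ zero    = refl
  1^ (suc k) = trans (*-identityˡ _) (1^ k)

  0^ : ∀ k .{{_ : NonZero k}} → 0# ^ k ≡ 0#
  0^ (suc k) = zeroˡ _

  ι≡× : ∀ k → ι k ≡ k ×K.× 1#
  ι≡× zero    = refl
  ι≡× (suc k) = cong (λ w → 1# + w) (ι≡× k)

  ι-+ : ∀ k l → ι (k ℕ.+ l) ≡ ι k + ι l
  ι-+ k l = trans (ι≡× (k ℕ.+ l)) (trans (×K.×-homo-+ 1# k l) (sym (cong₂ _+_ (ι≡× k) (ι≡× l))))

  ι-* : ∀ k l → ι (k ℕ.* l) ≡ ι k * ι l
  ι-* k l = trans (ι≡× (k ℕ.* l)) (trans (×K.×1-homo-* k l) (sym (cong₂ _*_ (ι≡× k) (ι≡× l))))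

  ι-^ : ∀ k l → ι (k ℕ.^ l) ≡ ι k ^ l
  ι-^ k zero    = +-identityʳ 1#
  ι-^ k (suc l) = trans (ι-* k (k ℕ.^ l)) (cong (ι k *_) (ι-^ k l))

  -- Translation by 1 permutes K, so summing all the elements gives q · 1 = 0.
  ι-p : ι p ≡ 0#
  ι-p = ^-zero (ι p) n (trans (sym (ι-^ p n)) (+-cancelˡ (ΣK.sum element) (ι q) 0# (begin
    ΣK.sum element + ι q                          ≡⟨ cong (λ w → ΣK.sum element + w)
        (trans (ι≡× q) (sym (ΣK.sum-replicate q))) ⟩
    ΣK.sum element + ΣK.sum {q} (λ _ → 1#)        ≡⟨ sym (ΣK.∑-distrib-+ element (λ _ → 1#)) ⟩
    ΣK.sum (λ i → element i + 1#)
        ≡⟨ sym (Reindex.sum-bijection +-commutativeMonoid (λ x → x) (_+ 1#) (_- 1#) l₁ l₂) ⟩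
    ΣK.sum element                                ≡⟨ sym (+-identityʳ _) ⟩
    ΣK.sum element + 0#                           ∎)))
    where
    open ≡-Reasoning
    l₁ : ∀ x → x - 1# + 1# ≡ x
    l₁ x = trans (+-assoc x _ _) (trans (cong (λ w → x + w) (-‿inverseˡ 1#)) (+-identityʳ x))
    l₂ : ∀ x → x + 1# - 1# ≡ x
    l₂ x = trans (+-assoc x _ _) (trans (cong (λ w → x + w) (-‿inverseʳ 1#)) (+-identityʳ x))

  ι-mod : ∀ k → ι (toℕ (modp {p} (+ k))) ≡ ι k
  ι-mod k = begin
    ι (toℕ (modp {p} (+ k)))               ≡⟨ cong ι (Finₚ.toℕ-fromℕ< (n%ℕd<d (+ k) p)) ⟩
    ι (k ℕ.% p)                            ≡⟨ sym (+-identityʳ _) ⟩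
    ι (k ℕ.% p) + 0#                       ≡⟨ cong (λ w → ι (k ℕ.% p) + w)
        (sym (trans (cong (ι (k ℕ./ p) *_) ι-p) (zeroʳ _))) ⟩
    ι (k ℕ.% p) + ι (k ℕ./ p) * ι p        ≡⟨ cong (λ w → ι (k ℕ.% p) + w) (sym (ι-* (k ℕ./ p) p)) ⟩
    ι (k ℕ.% p) + ι (k ℕ./ p ℕ.* p)        ≡⟨ sym (ι-+ (k ℕ.% p) _) ⟩
    ι (k ℕ.% p ℕ.+ k ℕ./ p ℕ.* p)          ≡⟨ cong ι (sym (m≡m%n+[m/n]*n k p)) ⟩
    ι k                                    ∎
    where open ≡-Reasoning

  -- The ring homomorphism from ℤ to K. Reducing mod p first avoids cases on the sign; `ι-p` makes
  -- the result independent of the representative.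
  ιℤ : ℤ → Carrier
  ιℤ a = ι (toℕ (modp {p} a))

  ιℤ-cong : ∀ {a b} → a ∼ b → ιℤ a ≡ ιℤ b
  ιℤ-cong e = cong (ι ∘ toℕ) (modp-cong e)

  ιℤ-+ : ∀ a b → ιℤ (a ℤ.+ b) ≡ ιℤ a + ιℤ b
  ιℤ-+ a b = trans (ιℤ-cong (+-cong-∼ (∼-sym (modp-∼ a)) (∼-sym (modp-∼ b))))
      (trans (ι-mod _) (ι-+ (toℕ (modp {p} a)) (toℕ (modp {p} b))))

  ιℤ-* : ∀ a b → ιℤ (a ℤ.* b) ≡ ιℤ a * ιℤ b
  ιℤ-* a b = trans (ιℤ-cong (∼-trans (*-cong-∼ (∼-sym (modp-∼ a)) (∼-sym (modp-∼ b)))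
          (∼-reflexive (sym (ℤₚ.pos-* i j))))) (trans (ι-mod (i ℕ.* j)) (ι-* i j))
    where
    i = toℕ (modp {p} a)
    j = toℕ (modp {p} b)

  ιℤ-1 : ιℤ (+ 1) ≡ 1#
  ιℤ-1 = trans (ι-mod 1) (+-identityʳ 1#)

  ιℤ-neg : ∀ a → ιℤ (ℤ.- a) ≡ - ιℤ a
  ιℤ-neg a = +-inverseˡ-unique (ιℤ (ℤ.- a)) (ιℤ a)
      (trans (sym (ιℤ-+ (ℤ.- a) a)) (trans (ιℤ-cong (∼-reflexive (ℤₚ.+-inverseˡ a))) (ι-mod 0)))

  ιℤ-minus : ∀ a b → ιℤ (a ℤ.- b) ≡ ιℤ a - ιℤ b
  ιℤ-minus a b = trans (ιℤ-+ a (ℤ.- b)) (cong (λ w → ιℤ a + w) (ιℤ-neg b))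

  unit-mod-p : ∀ a → ¬ (a ∼ + 0) → ∃ λ b → b ℤ.* a ∼ + 1
  unit-mod-p a a≁0 = helper (toℕ (modp {p} a)) refl
    where
    bézout : ∀ x y k l → 1 ℕ.+ x ℕ.* k ≡ y ℕ.* l → + 1 ℤ.+ + x ℤ.* + k ≡ + y ℤ.* + l
    bézout x y k l e = trans (cong (ℤ._+_ (+ 1)) (sym (ℤₚ.pos-* x k)))
        (trans (cong +_ e) (ℤₚ.pos-* y l))
    l₁ : ∀ y m → ℤ.- y ℤ.* m ℤ.- + 1 ≡ ℤ.- (+ 1 ℤ.+ y ℤ.* m)
    l₁ = solve-∀
    l₂ : ∀ x → + 1 ℤ.+ x ℤ.- + 1 ≡ x
    l₂ = solve-∀
    helper : ∀ k → toℕ (modp {p} a) ≡ k → ∃ λ b → b ℤ.* a ∼ + 1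
    helper zero    eq = contradiction (∼-trans (∼-sym (modp-∼ a)) (∼-reflexive (cong +_ eq))) a≁0
    helper (suc k) eq with coprime-Bézout
        (prime⇒coprime {n = suc k} pr (subst (ℕ._< p) eq (Finₚ.toℕ<n (modp {p} a))))
    -- Here 1 + y (k+1) = x p, so the inverse is -y; in the other case 1 + x p = y (k+1), so it is
    -- y.
    ... | Bézout.+- x y e = ℤ.- (+ y) , ∼-trans (*-cong-∼ (∼-refl {ℤ.- (+ y)}) a∼)
            (congruent (ℤ∣.divides (ℤ.- (+ x))
                    (trans (l₁ (+ y) (+ suc k)) (trans (cong ℤ.-_ (bézout y x (suc k) p e))
                        (ℤₚ.neg-distribˡ-* (+ x) (+ p))))))
      where
      a∼ : a ∼ + suc k
      a∼ = ∼-trans (∼-sym (modp-∼ a)) (∼-reflexive (cong +_ eq))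
    ... | Bézout.-+ x y e = + y , ∼-trans (*-cong-∼ (∼-refl {+ y}) a∼)
            (congruent (ℤ∣.divides (+ x) (trans (cong (ℤ._- + 1) (sym (bézout x y p (suc k) e)))
                      (l₂ (+ x ℤ.* + p)))))
      where
      a∼ : a ∼ + suc k
      a∼ = ∼-trans (∼-sym (modp-∼ a)) (∼-reflexive (cong +_ eq))

  -- An integer not divisible by p is a unit mod p, so its image in K is a unit and cannot be 0.
  ιℤ≡0⇒∼0 : ∀ a → ιℤ a ≡ 0# → a ∼ + 0
  ιℤ≡0⇒∼0 a e with a ∼? + 0
  ... | yes a∼0 = a∼0
  ... | no a≁0 with unit-mod-p a a≁0
  ... | b , ba∼1 = contradiction (begin
    0#               ≡⟨ sym (zeroʳ (ιℤ b)) ⟩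
    ιℤ b * 0#        ≡⟨ cong (ιℤ b *_) (sym e) ⟩
    ιℤ b * ιℤ a      ≡⟨ sym (ιℤ-* b a) ⟩
    ιℤ (b ℤ.* a)     ≡⟨ ιℤ-cong ba∼1 ⟩
    ιℤ (+ 1)         ≡⟨ ιℤ-1 ⟩
    1#               ∎) 0≢1
    where open ≡-Reasoning

  ιℤ-injective : ∀ a b → ιℤ a ≡ ιℤ b → a ∼ b
  ιℤ-injective a b e = minus∼0⁻¹ (ιℤ≡0⇒∼0 (a ℤ.- b)
        (trans (ιℤ-minus a b) (trans (cong (_- ιℤ b) e) (-‿inverseʳ (ιℤ b)))))

  ι-injective : ∀ {i j : Fin p} → ι (toℕ i) ≡ ι (toℕ j) → i ≡ j
  ι-injective {i} {j} e = ∼⇒≡ (ιℤ-injective (+ toℕ i) (+ toℕ j)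
        (trans (ι-mod (toℕ i)) (trans e (sym (ι-mod (toℕ j))))))

  ×≡ι* : ∀ k x → k ×K.× x ≡ ι k * x
  ×≡ι* k x = trans (cong (k ×K.×_) (sym (*-identityˡ x)))
      (trans (sym (×K.×-assoc-* k 1# x)) (cong (_* x) (sym (ι≡× k))))

  frobenius-+ : ∀ x y → (x + y) ^ p ≡ x ^ p + y ^ p
  frobenius-+ x y = helper p refl
    where
    open ≡-Reasoning
    open Binomial commutativeSemiring
    middle : ∀ k → p ℕ∣.∣ k → ∀ z → k ×K.× z ≡ 0#
    middle k (ℕ∣.divides c refl) z = begin
      (c ℕ.* p) ×K.× z  ≡⟨ ×≡ι* (c ℕ.* p) z ⟩
      ι (c ℕ.* p) * z   ≡⟨ cong (_* z) (trans (ι-* c p) (trans (cong (ι c *_) ι-p) (zeroʳ (ι c)))) ⟩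
      0# * z            ≡⟨ zeroˡ z ⟩
      0#                ∎
    -- With a variable r in place of p, matching on `suc r` exposes the two outer terms of the
    -- binomial expansion; all others are multiples of p.
    helper : ∀ r → r ≡ p → (x + y) ^ r ≡ x ^ r + y ^ r
    helper zero    eq = contradiction (sym eq) (ℕ.≢-nonZero⁻¹ p)
    helper (suc r) eq = begin
      (x + y) ^ suc r
        ≡⟨ trans (^≡ (x + y) (suc r)) (theorem (suc r) x y) ⟩
      t zero + ΣK.sum (t ∘ suc)
        ≡⟨ cong₂ _+_ first (SumSingle.sum-single +-commutativeMonoid (t ∘ suc) (fromℕ r) zeros) ⟩
      y ^ suc r + t (suc (fromℕ r))
        ≡⟨ cong (λ w → y ^ suc r + w) last ⟩
      y ^ suc r + x ^ suc r
        ≡⟨ +-comm _ _ ⟩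
      x ^ suc r + y ^ suc r ∎
      where
      t : Fin (suc (suc r)) → Carrier
      t = binomialTerm x y (suc r)
      first : t zero ≡ y ^ suc r
      first = trans (+-identityʳ _) (trans (*-identityˡ _) (sym (^≡ y (suc r))))
      zeros : ∀ i → i ≢ fromℕ r → t (suc i) ≡ 0#
      zeros i ne = middle (suc r C suc (toℕ i))
          (subst (λ r → p ℕ∣.∣ r C suc (toℕ i)) (sym eq)
            (prime∣C pr (suc (toℕ i)) (subst (suc (toℕ i) ℕ.<_) eq (ℕ.s≤s i<r)))) _
        where
        i<r : toℕ i ℕ.< r
        i<r = ℕₚ.≤∧≢⇒< (ℕ.s≤s⁻¹ (Finₚ.toℕ<n i)) λ e →
            ne (Finₚ.toℕ-injective (trans e (sym (Finₚ.toℕ-fromℕ r))))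
      last : t (suc (fromℕ r)) ≡ x ^ suc r
      last = begin
        t (suc (fromℕ r))
          ≡⟨ cong (λ k → (suc r C suc k) ×K.× (x ^K.^ suc k * y ^K.^ (r ℕ.∸ k)))
              (Finₚ.toℕ-fromℕ r) ⟩
        (suc r C suc r) ×K.× (x ^K.^ suc r * y ^K.^ (r ℕ.∸ r))
          ≡⟨ cong₂ (λ a b → a ×K.× (x ^K.^ suc r * y ^K.^ b)) (nCn≡1 (suc r)) (ℕₚ.n∸n≡0 r) ⟩
        x ^K.^ suc r * 1# + 0#
          ≡⟨ trans (+-identityʳ _) (*-identityʳ _) ⟩
        x ^K.^ suc r
          ≡⟨ sym (^≡ x (suc r)) ⟩
        x ^ suc r ∎

  frobenius-ι : ∀ k → ι k ^ p ≡ ι k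
  frobenius-ι zero    = 0^ p
  frobenius-ι (suc k) = trans (frobenius-+ 1# (ι k)) (cong₂ _+_ (1^ p) (frobenius-ι k))

  frobenius-minus : ∀ x y → (x - y) ^ p ≡ x ^ p - y ^ p
  frobenius-minus x y = +-cancelʳ (y ^ p) _ _ (begin
    (x - y) ^ p + y ^ p    ≡⟨ sym (frobenius-+ (x - y) y) ⟩
    (x - y + y) ^ p        ≡⟨ cong (_^ p) (l x y) ⟩
    x ^ p                  ≡⟨ sym (l (x ^ p) (y ^ p)) ⟩
    x ^ p - y ^ p + y ^ p  ∎)
    where
    open ≡-Reasoning
    l : ∀ x y → x - y + y ≡ x
    l x y = trans (+-assoc x _ _) (trans (cong (λ w → x + w) (-‿inverseˡ y)) (+-identityʳ x))

  product≢0 : ∀ {m} (t : Fin m → Carrier) → (∀ i → t i ≢ 0#) → ΠK.sum t ≢ 0#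
  product≢0 {zero}  t t≢0 e = 0≢1 (sym e)
  product≢0 {suc m} t t≢0 e = [ t≢0 zero , product≢0 (t ∘ suc) (t≢0 ∘ suc) ]′ (x*y≡0 e)

  product-const : ∀ m x → ΠK.sum {m} (λ _ → x) ≡ x ^ m
  product-const zero    x = refl
  product-const (suc m) x = cong (x *_) (product-const m x)

  -- Multiplication by x ≠ 0 permutes the nonzero elements; u and w patch the products at 0.
  fermat : ∀ x → x ^ q ≡ x
  fermat x with x ≟ 0#
  ... | yes refl = 0^ q {{ℕₚ.m^n≢0 p n}}
  ... | no x≢0 = *-cancelʳ (x ^ q) x U (product≢0 (u ∘ element) (u≢0 ∘ element)) (begin
    x ^ q * U
      ≡⟨ cong (_* U) (sym (product-const q x)) ⟩
    ΠK.sum {q} (λ _ → x) * U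
      ≡⟨ sym (ΠK.∑-distrib-+ {q} (λ _ → x) (u ∘ element)) ⟩
    ΠK.sum (λ i → x * u (element i))
      ≡⟨ ΠK.sum-cong-≗ {q} (λ i → sym (uw (element i))) ⟩
    ΠK.sum (λ i → w (element i) * u (x * element i))
      ≡⟨ ΠK.∑-distrib-+ (w ∘ element) (λ i → u (x * element i)) ⟩
    ΠK.sum (w ∘ element) * ΠK.sum (λ i → u (x * element i))
      ≡⟨ cong₂ _*_ ∏w (sym (Reindex.sum-bijection *-commutativeMonoid u (x *_) (x⁻¹ *_)
              (λ y → cancel x⁻¹ x y xx⁻¹) (λ y → cancel x x⁻¹ y (trans (*-comm x⁻¹ x) xx⁻¹)))) ⟩
    x * U ∎)
    where
    open ≡-Reasoning
    x⁻¹ = proj₁ (inverse x x≢0)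
    xx⁻¹ = proj₂ (inverse x x≢0)
    u w : Carrier → Carrier
    u y with y ≟ 0#
    ... | yes _ = 1#
    ... | no  _ = y
    w y with y ≟ 0#
    ... | yes _ = x
    ... | no  _ = 1#
    U = ΠK.sum (u ∘ element)
    u≢0 : ∀ y → u y ≢ 0#
    u≢0 y e with y ≟ 0#
    ... | yes _  = 0≢1 (sym e)
    ... | no y≢0 = y≢0 e
    uw : ∀ y → w y * u (x * y) ≡ x * u y
    uw y with y ≟ 0# | (x * y) ≟ 0#
    ... | yes _    | yes _ = refl
    ... | yes refl | no ne = contradiction (zeroʳ x) ne
    ... | no y≢0   | yes e = contradiction e λ e → [ x≢0 , y≢0 ]′ (x*y≡0 e)
    ... | no _     | no _  = *-identityˡ _
    cancel : ∀ a b y → b * a ≡ 1# → b * (a * y) ≡ y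
    cancel a b y e = trans (sym (*-assoc b a y)) (trans (cong (_* y) e) (*-identityˡ y))
    w0 : w 0# ≡ x
    w0 with 0# ≟ 0#
    ... | yes _ = refl
    ... | no ne = contradiction refl ne
    w≢0 : ∀ y → y ≢ 0# → w y ≡ 1#
    w≢0 y y≢0 with y ≟ 0#
    ... | yes e = contradiction e y≢0
    ... | no _  = refl
    ∏w : ΠK.sum (w ∘ element) ≡ x
    ∏w = trans (SumSingle.sum-single *-commutativeMonoid (w ∘ element) (index 0#) λ i ne → w≢0
          (element i) λ e → ne (trans (sym (index-element i)) (cong index e)))
               (trans (cong w (element-index 0#)) w0)

-- The recursions behind TrK, Tr and gluedF are local to where-blocks of Defs and cannot be named.
-- Each is recovered as the solution of a placeholder `_`, determined by unification with the goal
-- of the adjacent lemma; the with-abstractions there turn all arguments of the local function into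
-- distinct variables, which makes this unification problem solvable.
module TraceRecursion where
  open FiniteField

  trace-partial : ∀ {p n} (K : FiniteField p n) → Carrier K → ℕ → Carrier K
  -- Trivial as a statement: `Q` only puts the trace into the goal. The exponent `suc n` makes it
  -- unfold once, so that the local recursion appears applied to a variable.
  trace-partial-capture : ∀ {p n} (K : FiniteField p (suc n)) (x : Carrier K)
      (Q : Carrier K → Set) → (∀ z → Q z) → Q (TrK K x)
  trace-partial K x i = _
  trace-partial-capture {p} {n} K x Q q with _+_ K (_^_ K x (p ℕ.^ n))
  ... | a with suc n | K | x
  ... | w | K | x = q (a (trace-partial K x n))

  trace-search : ∀ {p n} (K : FiniteField p n) → Carrier K → ℕ → ℕ
  trace-search-capture : ∀ {p n} (K : FiniteField (suc p) n) (x : Carrier K) (Q : ℕ → Set) →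
      (∀ z → Q z) → Q (Tr K x)
  trace-search K x i = _
  trace-search-capture {p} {n} K x Q q with Inverse.to (enum K)
      (ι K (p ℕ.∸ p)) Finₚ.≟ Inverse.to (enum K) (TrK K x)
  ... | yes _ = q _
  ... | no _ with suc p | K | x
  ... | w | K | x = q (trace-search K x p)

open TraceRecursion

-- Polynomial functions on K and their roots.

module Trace {p n : ℕ} .{{_ : NonZero p}} (pr : Prime p) (K : FiniteField p n) where
  open FiniteField K
  open Cyclotomic p
  open FieldTheory pr K
  open NaturalSolver commutativeSemiring using (solve; _:+_; _:*_; _:=_)

  -- f is a polynomial function of degree at most d with coefficient c at x^d, expressed through
  -- iterated divided differences.
  Deg : ℕ → Carrier → (Carrier → Carrier) → Set
  Deg zero    c f = ∀ x → f x ≡ c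
  Deg (suc d) c f = ∀ r → ∃ λ g → Deg d c g × (∀ x → f x ≡ f r + (x - r) * g x)

  Deg-cong : ∀ d {c f g} → (∀ x → f x ≡ g x) → Deg d c f → Deg d c g
  Deg-cong zero    f≗g df x = trans (sym (f≗g x)) (df x)
  Deg-cong (suc d) f≗g df r with df r
  ... | h , dh , eq = h , dh , λ x → trans (sym (f≗g x)) (trans (eq x) (cong (_+ _) (f≗g r)))

  Deg-+ : ∀ d {a b f g} → Deg d a f → Deg d b g → Deg d (a + b) (λ x → f x + g x)
  Deg-+ zero    df dg x = cong₂ _+_ (df x) (dg x)
  Deg-+ (suc d) {f = f} {g} df dg r with df r | dg r
  ... | f′ , df′ , ef | g′ , dg′ , eg = _ , Deg-+ d df′ dg′ , λ x → trans (cong₂ _+_ (ef x) (eg x))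
    (solve 5 (λ a b t u v → (a :+ t :* u) :+ (b :+ t :* v) := (a :+ b) :+ t :* (u :+ v)) refl (f r)
          (g r) (x - r) (f′ x) (g′ x))

  Deg-scale : ∀ d a {c f} → Deg d c f → Deg d (a * c) (λ x → a * f x)
  Deg-scale zero    a df x = cong (a *_) (df x)
  Deg-scale (suc d) a {f = f} df r with df r
  ... | f′ , df′ , ef = _ , Deg-scale d a df′ , λ x → trans (cong (a *_) (ef x))
    (solve 4 (λ a b t u → a :* (b :+ t :* u) := a :* b :+ t :* (a :* u)) refl a (f r) (x - r)
          (f′ x))

  Deg-lift : ∀ d {c f} → Deg d c f → Deg (suc d) 0# f
  Deg-lift zero    {c} {f} df r = (λ _ → 0#) , (λ _ → refl) , λ x →
    trans (df x) (sym (trans (cong₂ _+_ (df r) (zeroʳ (x - r))) (+-identityʳ c)))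
  Deg-lift (suc d) df r with df r
  ... | g , dg , eq = g , Deg-lift d dg , eq

  Deg-lift< : ∀ {d e c f} → d ℕ.< e → Deg d c f → Deg e 0# f
  Deg-lift< {d} {_} {c} {f} d<e df = lift (ℕₚ.≤⇒≤′ d<e)
    where
    lift : ∀ {e} → suc d ℕ.≤′ e → Deg e 0# f
    lift (ℕ.≤′-reflexive refl) = Deg-lift d {c} df
    lift (ℕ.≤′-step {e} le)    = Deg-lift e {0#} (lift le)

  Deg-linear : ∀ d a {c f} → Deg d c f → Deg (suc d) c (λ x → (x - a) * f x)
  Deg-linear d a {c} {f} df r with Deg-lift d df r
  -- The divided difference of (x - a) f at r is f + (r - a) g. Lifting f first gives g the formal
  -- degree d with coefficient 0, so the coefficient c of f survives.
  ... | g , dg , eq = _ , subst (λ c → Deg d c _) c+≡c (Deg-+ d df (Deg-scale d (r - a) dg)) , λ x →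
      begin
    (x - a) * f x
      ≡⟨ cong₂ _*_ (split x) (eq x) ⟩
    ((x - r) + (r - a)) * (f r + (x - r) * g x)
      ≡⟨ solve 4 (λ t s u v → (t :+ s) :* (u :+ t :* v) := s :* u :+ t :*
            ((u :+ t :* v) :+ s :* v)) refl (x - r) (r - a) (f r) (g x) ⟩
    (r - a) * f r + (x - r) * ((f r + (x - r) * g x) + (r - a) * g x)
      ≡⟨ cong (λ w → (r - a) * f r + (x - r) * (w + (r - a) * g x)) (sym (eq x)) ⟩
    (r - a) * f r + (x - r) * (f x + (r - a) * g x) ∎
    where
    open ≡-Reasoning
    c+≡c : c + (r - a) * 0# ≡ c
    c+≡c = trans (cong (λ w → c + w) (zeroʳ (r - a))) (+-identityʳ c)
    split : ∀ x → x - a ≡ (x - r) + (r - a)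
    split x = sym (trans (+-assoc x (- r) (r - a))
          (cong (λ w → x + w) (trans (sym (+-assoc (- r) r (- a)))
              (trans (cong (_- a) (-‿inverseˡ r)) (+-identityˡ (- a))))))

  Deg-^ : ∀ d → Deg d 1# (_^ d)
  Deg-^ zero    x = refl
  Deg-^ (suc d) = Deg-cong (suc d) (λ x → cong (_* x ^ d)
        (trans (cong (λ w → x + w) -0#≈0#) (+-identityʳ x))) (Deg-linear d 0# (Deg-^ d))

  Deg-product : ∀ m (a : Fin m → Carrier) → Deg m 1# (λ x → ΠK.sum (λ i → x - a i))
  Deg-product zero    a x = refl
  Deg-product (suc m) a   = Deg-linear m (a zero) (Deg-product m (a ∘ suc))

  minus≡0 : ∀ {x y} → x - y ≡ 0# → x ≡ y
  minus≡0 = x∙y⁻¹≈ε⇒x≈y _ _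

  quotient-root : ∀ {f g : Carrier → Carrier} {r} → (∀ x → f x ≡ f r + (x - r) * g x) → f r ≡ 0# →
      ∀ x → x ≢ r → f x ≡ 0# → g x ≡ 0#
  quotient-root {f} {g} {r} eq fr≡0 x x≢r fx≡0 with x*y≡0
      (trans (sym (trans (eq x) (trans (cong (_+ _) fr≡0) (+-identityˡ _)))) fx≡0)
  ... | inj₁ e = contradiction (minus≡0 e) x≢r
  ... | inj₂ e = e

  -- Dividing out one root leaves a quotient of lower degree with the same leading coefficient that
  -- vanishes at the other roots; after d divisions only the constant c is left.
  Deg-leading : ∀ d {c f} → Deg d c f → (ρ : Fin (suc d) → Carrier) →
      (∀ {i j} → ρ i ≡ ρ j → i ≡ j) → (∀ i → f (ρ i) ≡ 0#) → c ≡ 0#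
  Deg-leading zero    df ρ inj roots = trans (sym (df (ρ zero))) (roots zero)
  Deg-leading (suc d) df ρ inj roots with df (ρ zero)
  ... | g , dg , eq = Deg-leading d dg (ρ ∘ suc) (Finₚ.suc-injective ∘ inj)
        λ i → quotient-root eq (roots zero) _ (λ e → contradiction (inj e) λ ()) (roots (suc i))

  -- `Deg d 0#` means degree below d, so d roots suffice. This form gives the value at every x, as
  -- `wilson` requires.
  Deg-vanish : ∀ d {f} → Deg d 0# f → (ρ : Fin d → Carrier) → (∀ {i j} → ρ i ≡ ρ j → i ≡ j) →
      (∀ i → f (ρ i) ≡ 0#) → ∀ x → f x ≡ 0#
  Deg-vanish zero    df ρ inj roots x = df x
  Deg-vanish (suc d) df ρ inj roots x with df (ρ zero)
  ... | g , dg , eq = trans (eq x) (trans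
        (cong₂ _+_ (roots zero) (trans (cong ((x - ρ zero) *_) (g≡0 x)) (zeroʳ _)))
        (+-identityʳ 0#))
    where
    g≡0 : ∀ x → g x ≡ 0#
    g≡0 = Deg-vanish d dg (ρ ∘ suc) (Finₚ.suc-injective ∘ inj) λ i → quotient-root eq (roots zero) _
        (λ e → contradiction (inj e) λ ()) (roots (suc i))

  1<p : 1 ℕ.< p
  1<p = ℕ.nonTrivial⇒n>1 p {{prime⇒nonTrivial pr}}

  -1*x≡-x : ∀ x → - 1# * x ≡ - x
  -1*x≡-x x = trans (sym (-‿distribˡ-* 1# x)) (cong -_ (*-identityˡ x))

  -- x^p − x has at most p roots, and the p elements of the prime field are roots.
  fixed⇒prime-field : ∀ y → y ^ p ≡ y → ∃ λ (i : Fin p) → ι (toℕ i) ≡ y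
  fixed⇒prime-field y y^p≡y with Finₚ.any? (λ i → ι (toℕ i) ≟ y)
  ... | yes found = found
  ... | no none = contradiction (sym (Deg-leading p poly ρ ρ-injective roots))
      (0≢1 ∘ λ e → trans e 1+≡1)
    where
    1+≡1 : 1# + - 1# * 0# ≡ 1#
    1+≡1 = trans (cong (λ w → 1# + w) (zeroʳ (- 1#))) (+-identityʳ 1#)
    poly : Deg p (1# + - 1# * 0#) (λ x → x ^ p + - 1# * (x ^ 1))
    poly = Deg-+ p (Deg-^ p) (Deg-scale p (- 1#) (Deg-lift< 1<p (Deg-^ 1)))
    ρ : Fin (suc p) → Carrier
    ρ zero    = y
    ρ (suc i) = ι (toℕ i)
    ρ-injective : ∀ {i j} → ρ i ≡ ρ j → i ≡ j
    ρ-injective {zero}  {zero}  e = refl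
    ρ-injective {zero}  {suc j} e = contradiction (j , sym e) none
    ρ-injective {suc i} {zero}  e = contradiction (i , e) none
    ρ-injective {suc i} {suc j} e = cong suc (ι-injective e)
    root : ∀ x → x ^ p ≡ x → x ^ p + - 1# * (x ^ 1) ≡ 0#
    root x e = trans (cong₂ _+_ e (trans (-1*x≡-x (x ^ 1)) (cong -_ (*-identityʳ x))))
        (-‿inverseʳ x)
    roots : ∀ i → ρ i ^ p + - 1# * (ρ i ^ 1) ≡ 0#
    roots zero    = root y y^p≡y
    roots (suc i) = root (ι (toℕ i)) (frobenius-ι (toℕ i))

  -- The trace: additivity, values in the prime field, nontriviality.

  partial : Carrier → ℕ → Carrier
  partial = trace-partial K

  ^p^ : ∀ x i → (x ^ (p ℕ.^ i)) ^ p ≡ x ^ (p ℕ.^ suc i)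
  ^p^ x i = trans (^-* x (p ℕ.^ i) p) (cong (x ^_) (ℕₚ.*-comm (p ℕ.^ i) p))

  frobenius^-+ : ∀ i x y → (x + y) ^ (p ℕ.^ i) ≡ x ^ (p ℕ.^ i) + y ^ (p ℕ.^ i)
  frobenius^-+ zero    x y = trans (*-identityʳ _) (sym (cong₂ _+_ (*-identityʳ x) (*-identityʳ y)))
  frobenius^-+ (suc i) x y = trans (sym (^p^ (x + y) i))
      (trans (cong (_^ p) (frobenius^-+ i x y))
        (trans (frobenius-+ _ _) (cong₂ _+_ (^p^ x i) (^p^ y i))))

  -- `partial x i` is the sum of x^(p^j) over j < i. The power p moves each exponent one step up,
  -- and only the term x at the bottom is missing.
  partial-frobenius : ∀ x i → partial x i ^ p + x ≡ partial x (suc i)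
  partial-frobenius x zero    = trans (cong (_+ x) (0^ p))
      (trans (+-comm 0# x) (cong (_+ 0#) (sym (*-identityʳ x))))
  partial-frobenius x (suc i) = trans
      (cong (_+ x) (trans (frobenius-+ _ _) (cong (_+ partial x i ^ p) (^p^ x i))))
      (trans (+-assoc _ _ x) (cong (λ w → x ^ (p ℕ.^ suc i) + w) (partial-frobenius x i)))

  partial-+ : ∀ x y i → partial (x + y) i ≡ partial x i + partial y i
  partial-+ x y zero    = sym (+-identityʳ 0#)
  partial-+ x y (suc i) = trans (cong₂ _+_ (frobenius^-+ i x y) (partial-+ x y i))
    (solve 4 (λ a b c d → (a :+ b) :+ (c :+ d) := (a :+ c) :+ (b :+ d)) refl (x ^ (p ℕ.^ i))
          (y ^ (p ℕ.^ i)) (partial x i) (partial y i))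

  TrK-+ : ∀ x y → TrK (x + y) ≡ TrK x + TrK y
  TrK-+ x y = partial-+ x y n

  -- Frobenius trades the term x of the trace for x^q, and these are equal by `fermat`.
  TrK-fixed : ∀ x → TrK x ^ p ≡ TrK x
  TrK-fixed x = +-cancelʳ x _ _ (trans (partial-frobenius x n)
        (trans (cong (_+ TrK x) (fermat x)) (+-comm x (TrK x))))

  -- With k steps left the candidates p-k, ..., p-1 are untried. A solution among them keeps the
  -- default 0 of the exhausted search out of reach.
  search-correct : ∀ x k → k ℕ.≤ p → (∃ λ j → p ℕ.∸ k ℕ.≤ j × j ℕ.< p × ι j ≡ TrK x) →
      ι (trace-search K x k) ≡ TrK x
  search-correct x zero    k≤p (j , p≤j , j<p , _) = contradiction p≤j (ℕₚ.<⇒≱ j<p)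
  search-correct x (suc k) k<p (j , le , j<p , e) with index (ι (p ℕ.∸ suc k)) Finₚ.≟ index (TrK x)
  ... | yes eq = index-injective eq
  ... | no neq = search-correct x k (ℕₚ.<⇒≤ k<p)
      (j , subst (ℕ._≤ j) (sym (ℕₚ.+-∸-assoc 1 k<p))
        (ℕₚ.≤∧≢⇒< le λ { refl → neq (cong index e) }) , j<p , e)

  Tr-correct : ∀ x → ιℤ (+ Tr x) ≡ TrK x
  Tr-correct x with fixed⇒prime-field (TrK x) (TrK-fixed x)
  ... | i , e = trans (ι-mod (Tr x)) (search-correct x p ℕₚ.≤-refl
        (toℕ i , subst (ℕ._≤ toℕ i) (sym (ℕₚ.n∸n≡0 p)) ℕ.z≤n , Finₚ.toℕ<n i , e))

  Tr-+ : ∀ x y → + Tr (x + y) ∼ + Tr x ℤ.+ + Tr y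
  Tr-+ x y = ιℤ-injective _ _ (trans (Tr-correct (x + y))
        (trans (TrK-+ x y) (sym (trans (ιℤ-+ (+ Tr x) (+ Tr y))
              (cong₂ _+_ (Tr-correct x) (Tr-correct y))))))

  -- Induction alternating between the two lemmas: the partial trace before x^(p^i) has degree below
  -- p^i, so adding this power makes it monic of degree p^i.
  Deg-partial-low : ∀ i → Deg (p ℕ.^ i) 0# (λ x → partial x i)
  Deg-partial : ∀ i → Deg (p ℕ.^ i) (1# + 0#) (λ x → partial x (suc i))
  Deg-partial-low zero    = Deg-lift 0 (λ _ → refl)
  Deg-partial-low (suc i) = Deg-lift< (ℕₚ.^-monoʳ-< p 1<p (ℕₚ.n<1+n i)) (Deg-partial i)
  Deg-partial i = Deg-+ (p ℕ.^ i) (Deg-^ (p ℕ.^ i)) (Deg-partial-low i)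

  -- The trace is a polynomial of degree p^(n-1), so it cannot vanish at all p^n elements.
  TrK-nontrivial : n ≥ 1 → ∃ λ u → TrK u ≢ 0#
  TrK-nontrivial n≥1 with Finₚ.¬∀⟶∃¬ q (λ i → TrK (element i) ≡ 0#) (λ i → TrK (element i) ≟ 0#)
      (λ all → not-all n refl n≥1 all)
    where
    not-all : ∀ m → m ≡ n → m ℕ.≥ 1 → ¬ (∀ i → TrK (element i) ≡ 0#)
    not-all (suc m) eq _ all = 0≢1 (sym
          (trans (sym (+-identityʳ 1#)) (Deg-leading (p ℕ.^ m)
              (subst (λ n → Deg (p ℕ.^ m) (1# + 0#) (λ x → partial x n)) eq (Deg-partial m))
        (λ i → element (Fin.inject≤ i le))
            (λ e → Finₚ.inject≤-injective le le _ _ (element-injective e)) (λ i → all _))))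
      where
      le : suc (p ℕ.^ m) ℕ.≤ q
      le = subst (λ n → suc (p ℕ.^ m) ℕ.≤ p ℕ.^ n) eq (ℕₚ.^-monoʳ-< p 1<p (ℕₚ.n<1+n m))
  ... | i , ne = element i , ne

  -- Wilson's theorem inside K.

  ι-injective-< : ∀ {a b} → a ℕ.< p → b ℕ.< p → ι a ≡ ι b → a ≡ b
  ι-injective-< a<p b<p e = Finₚ.fromℕ<-injective _ _ a<p b<p
      (ι-injective (trans (cong ι (Finₚ.toℕ-fromℕ< a<p))
          (trans e (cong ι (sym (Finₚ.toℕ-fromℕ< b<p))))))

  product-zero : ∀ {m} (t : Fin m → Carrier) i → t i ≡ 0# → ΠK.sum t ≡ 0#
  product-zero {suc m} t i e = trans (ΠK.sum-remove {i = i} t)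
      (trans (cong (_* ΠK.sum (t ∘ punchIn i)) e) (zeroˡ _))

  -- ∏ (x − ιj + ιy) over j ≠ y and x^(p−1) − 1 are monic of degree p − 1 with the same p − 1 roots,
  -- so they agree at 0.
  wilson : ∀ m → suc m ≡ p → (y : Fin (suc m)) →
      ΠK.sum {m} (λ i → ι (toℕ y) - ι (toℕ (punchIn y i))) ≡ - 1#
  wilson m eq y = begin
    ΠK.sum {m} (λ i → ι (toℕ y) - ι (toℕ (punchIn y i)))
      ≡⟨ ΠK.sum-cong-≗ {m} (λ i → sym (trans (+-identityˡ _) (neg-minus _ _))) ⟩
    T 0#
      ≡⟨ sym (trans (cong (λ w → T 0# + w) (+-cancel)) (+-identityʳ _)) ⟩
    T 0# + ((- 1# * 0# ^ m + 1#) + - 1#)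
      ≡⟨ sym (+-assoc _ _ _) ⟩
    (T 0# + (- 1# * 0# ^ m + 1#)) + - 1#
      ≡⟨ cong (_+ - 1#) (Deg-vanish m (subst
              (λ c → Deg m c (λ x → T x + (- 1# * x ^ m + 1#))) c≡0 poly) a a-injective roots 0#) ⟩
    0# + - 1#
      ≡⟨ +-identityˡ _ ⟩
    - 1# ∎
    where
    open ≡-Reasoning
    m≥1 : 1 ℕ.≤ m
    m≥1 = ℕ.s≤s⁻¹ (subst (1 ℕ.<_) (sym eq) 1<p)
    instance
      m≢0 : NonZero m
      m≢0 = ℕ.>-nonZero m≥1
    neg-minus : ∀ x y → - (x - y) ≡ y - x
    neg-minus x y = sym (minus≡0 (begin
      (y - x) - - (x - y)     ≡⟨ cong (λ w → y - x + w) (-‿involutive (x - y)) ⟩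
      (y - x) + (x - y)       ≡⟨ solve 4
          (λ a b c d → (a :+ b) :+ (c :+ d) := (a :+ d) :+ (c :+ b)) refl y (- x) x (- y) ⟩
      (y - y) + (x - x)       ≡⟨ cong₂ _+_ (-‿inverseʳ y) (-‿inverseʳ x) ⟩
      0# + 0#                 ≡⟨ +-identityʳ 0# ⟩
      0#                      ∎))
    a : Fin m → Carrier
    a i = ι (toℕ (punchIn y i)) - ι (toℕ y)
    T : Carrier → Carrier
    T x = ΠK.sum (λ i → x - a i)
    +-cancel : (- 1# * 0# ^ m + 1#) + - 1# ≡ 0#
    +-cancel = trans (cong (λ w → (w + 1#) + - 1#) (trans (cong (- 1# *_) (0^ m)) (zeroʳ _)))
        (trans (cong (_+ - 1#) (+-identityˡ 1#)) (-‿inverseʳ 1#))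
    c≡0 : 1# + (- 1# * 1# + 0#) ≡ 0#
    c≡0 = trans (cong (λ w → 1# + w) (trans (+-identityʳ _) (*-identityʳ _))) (-‿inverseʳ 1#)
    poly : Deg m (1# + (- 1# * 1# + 0#)) (λ x → T x + (- 1# * x ^ m + 1#))
    poly = Deg-+ m (Deg-product m a) (Deg-+ m (Deg-scale m (- 1#) (Deg-^ m))
          (Deg-lift< m≥1 (λ _ → refl)))
    bound : ∀ (i : Fin (suc m)) → toℕ i ℕ.< p
    bound i = subst (toℕ i ℕ.<_) eq (Finₚ.toℕ<n i)
    a-injective : ∀ {i j} → a i ≡ a j → i ≡ j
    a-injective e = Finₚ.punchIn-injective y _ _
        (Finₚ.toℕ-injective (ι-injective-< (bound _) (bound _) (+-cancelʳ (- ι (toℕ y)) _ _ e)))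
    a≢0 : ∀ i → a i ≢ 0#
    a≢0 i e = Finₚ.punchInᵢ≢i y i (Finₚ.toℕ-injective
          (ι-injective-< (bound _) (bound _) (minus≡0 e)))
    a^m≡1 : ∀ i → a i ^ m ≡ 1#
    a^m≡1 i = *-cancelʳ _ _ (a i) (a≢0 i) (begin
      a i ^ m * a i   ≡⟨ *-comm _ _ ⟩
      a i ^ suc m     ≡⟨ cong (a i ^_) eq ⟩
      a i ^ p         ≡⟨ trans (frobenius-minus (ι (toℕ (punchIn y i))) (ι (toℕ y)))
          (cong₂ _-_ (frobenius-ι (toℕ (punchIn y i))) (frobenius-ι (toℕ y))) ⟩
      a i             ≡⟨ sym (*-identityˡ _) ⟩
      1# * a i        ∎)
    roots : ∀ i → T (a i) + (- 1# * a i ^ m + 1#) ≡ 0#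
    roots i = trans (cong₂ _+_ (product-zero (λ j → a i - a j) i (-‿inverseʳ (a i)))
          (trans (cong (λ w → - 1# * w + 1#) (a^m≡1 i))
            (trans (cong (_+ 1#) (*-identityʳ _)) (-‿inverseˡ 1#)))) (+-identityʳ 0#)

  -- The form in which the product occurs in `gluedF`: the omitted factor is present as a 1 at index
  -- y.
  wilson-product : ∀ r → r ≡ p → (y : Fin r) (t : Fin r → Carrier) → t y ≡ 1# →
      (∀ j → j ≢ y → t j ≡ ι (toℕ y) - ι (toℕ j)) → ΠK.sum t ≡ - 1#
  wilson-product (suc m) eq y t ty≡1 t≡ = trans (ΠK.sum-remove {i = y} t)
      (trans (cong₂ _*_ ty≡1 (trans (ΠK.sum-cong-≗ {m} (λ i → t≡ (punchIn y i)
                (Finₚ.punchInᵢ≢i y i))) (wilson m eq y))) (*-identityˡ _))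

-- The interpolation formula for F.

module GluingRecursion where
  open FiniteField using (Carrier)

  summand : ∀ {p n} .{{_ : NonZero p}} (K : FiniteField p n) (f : Fin p → Carrier K → Fin p)
      (x : Carrier K) (y k : Fin p) → ℤ
  gluedF≡∑ : ∀ {p n} .{{_ : NonZero p}} (K : FiniteField p n) (f : Fin p → Carrier K → Fin p)
      (x : Carrier K) (y : Fin p) →
    gluedF K f x y ≡ modp (+ (p ℕ.∸ 1) ℤ.* sumℤ {p} p (summand K f x y))
  summand K f x y k = _
  gluedF≡∑ K f x y = refl

  product : ∀ {p n} .{{_ : NonZero p}} (K : FiniteField p n) (f : Fin p → Carrier K → Fin p)
      (x : Carrier K) (y : Fin p) (m : ℕ) (h : Fin m → ℤ) → ℤ
  -- ℤ.sign and ℤ.∣_∣ are abstracted too, since ℤ._*_ unfolds to them and they would block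
  -- unification. For k = 0 the factors with j ≥ 1 are just y − j, so that they can be abstracted.
  product-capture : ∀ {p n} .{{nz : NonZero (suc p)}} (K : FiniteField (suc p) n)
      (f : Fin (suc p) → Carrier K → Fin (suc p)) (x : Carrier K) (y : Fin (suc p))
    (Q : ℤ → Set) → (∀ z → Q z) → Q (summand {{nz}} K f x y zero)
  product K f x y m h = _
  product-capture {p} {n} K f x y Q q with toℕ (f zero x) |
      (λ i → + toℕ y ℤ.- + toℕ (Fin.suc {p} i)) | ℤ.sign | ℤ.∣_∣
  ... | t | h | s | a with suc p | K | f | x | y
  ... | w | K | f | x | y = q ((s z Sign.* Sign.+) ℤ.◃ (a z ℕ.* t))
    where z = s (product K f x y p h) ℤ.◃ (a (product K f x y p h) ℕ.+ 0)

  factor : ∀ {p n} .{{_ : NonZero p}} (K : FiniteField p n) (f : Fin p → Carrier K → Fin p)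
      (x : Carrier K) (y k j : Fin p) → ℤ
  summand≡ : ∀ {p n} .{{_ : NonZero p}} (K : FiniteField p n) (f : Fin p → Carrier K → Fin p)
      (x : Carrier K) (y k : Fin p) →
    summand K f x y k ≡ product K f x y p (factor K f x y k) ℤ.* + toℕ (f k x)
  factor K f x y k j = _
  summand≡ K f x y k = refl

open GluingRecursion

module Gluing {p n : ℕ} .{{_ : NonZero p}} (pr : Prime p) (K : FiniteField p n)
    (f : Fin p → FiniteField.Carrier K → Fin p) (x : FiniteField.Carrier K) (y : Fin p) where
  open FiniteField K
  open Cyclotomic p
  open FieldTheory pr K
  open Trace pr K

  factor-same : ∀ k → factor K f x y k k ≡ + 1
  factor-same k with toℕ k ℕ.≟ toℕ k
  ... | yes _ = refl
  ... | no ne = contradiction refl ne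

  factor-other : ∀ k j → j ≢ k → factor K f x y k j ≡ + toℕ y ℤ.- + toℕ j
  factor-other k j ne with toℕ j ℕ.≟ toℕ k
  ... | yes e = contradiction (Finₚ.toℕ-injective e) ne
  ... | no _  = refl

  product-zero-factor : ∀ m (h : Fin m → ℤ) i → h i ≡ + 0 → product K f x y m h ≡ + 0
  product-zero-factor (suc m) h zero    e = cong (ℤ._* product K f x y m (h ∘ suc)) e
  product-zero-factor (suc m) h (suc i) e = trans
      (cong (h zero ℤ.*_) (product-zero-factor m (h ∘ suc) i e)) (ℤₚ.*-zeroʳ (h zero))

  ιℤ-product : ∀ m (h : Fin m → ℤ) → ιℤ (product K f x y m h) ≡ ΠK.sum (ιℤ ∘ h)
  ιℤ-product zero    h = ιℤ-1
  ιℤ-product (suc m) h = trans (ιℤ-* (h zero) _) (cong (ιℤ (h zero) *_) (ιℤ-product m (h ∘ suc)))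

  -- For k ≠ y the product over j ≠ k contains the factor y - y.
  ∑summand : sumℤ {p} p (summand K f x y) ≡ summand K f x y y
  ∑summand = trans (sumℤ≡sum p _) (SumSingle.sum-single ℤₚ.+-0-commutativeMonoid (summand K f x y) y
        λ k k≢y →
    trans (summand≡ K f x y k) (cong (ℤ._* + toℕ (f k x))
          (product-zero-factor p _ y (trans (factor-other k y (k≢y ∘ sym))
              (ℤₚ.+-inverseʳ (+ toℕ y))))))

  ιℤ-product-y : ιℤ (product K f x y p (factor K f x y y)) ≡ - 1#
  ιℤ-product-y = trans (ιℤ-product p _)
      (wilson-product p refl y _ (trans (cong ιℤ (factor-same y)) ιℤ-1) λ j j≢y →
    trans (cong ιℤ (factor-other y j j≢y))
        (trans (ιℤ-minus (+ toℕ y) (+ toℕ j)) (cong₂ _-_ (ι-mod (toℕ y)) (ι-mod (toℕ j)))))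

  ιℤ-p-1 : ιℤ (+ (p ℕ.∸ 1)) ≡ - 1#
  ιℤ-p-1 = +-inverseˡ-unique _ 1# (trans (cong (_+ 1#) (ι-mod (p ℕ.∸ 1)))
        (trans (+-comm _ 1#) (trans (cong ι (ℕₚ.suc-pred p)) ι-p)))

  -- The constant p - 1 is -1 mod p and cancels the -1 of Wilson's theorem.
  gluedF≡ : gluedF K f x y ≡ f y x
  gluedF≡ = trans (gluedF≡∑ K f x y) (trans
        (modp-cong (ιℤ-injective (+ (p ℕ.∸ 1) ℤ.* S) (+ t) (begin
    ιℤ (+ (p ℕ.∸ 1) ℤ.* S)
      ≡⟨ ιℤ-* (+ (p ℕ.∸ 1)) S ⟩
    ιℤ (+ (p ℕ.∸ 1)) * ιℤ S
      ≡⟨ cong₂ _*_ ιℤ-p-1 (trans (cong ιℤ (trans ∑summand (summand≡ K f x y y)))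
            (trans (ιℤ-* (product K f x y p (factor K f x y y)) (+ t))
              (cong (_* ιℤ (+ t)) ιℤ-product-y))) ⟩
    - 1# * (- 1# * ιℤ (+ t))
      ≡⟨ trans (-1*x≡-x _) (trans (cong -_ (-1*x≡-x _)) (-‿involutive _)) ⟩
    ιℤ (+ t) ∎))) (modp-toℕ (f y x)))
    where
    open ≡-Reasoning
    t = toℕ (f y x)
    S = sumℤ {p} p (summand K f x y)

-- Orthogonality of characters and Parseval's identity.

module Fourier {p n : ℕ} .{{_ : NonZero p}} (pr : Prime p) (n≥1 : n ≥ 1) (K : FiniteField p n) where
  open FiniteField K
  open Cyclotomic p
  open FieldTheory pr K
  open Trace pr K

  1F : Fin p
  1F = modp (+ 1)

  1≁0 : ¬ (+ 1 ∼ + 0)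
  1≁0 e = 0≢1 (trans (sym (ι-mod 0)) (trans (sym (ιℤ-cong e)) ιℤ-1))

  module _ (x y : Carrier) (x≢y : x ≢ y) where

    -- Congruent to Tr(b(y - x)): the exponent of the quotient of the characters at y and x,
    -- additive in b.
    d : Carrier → ℤ
    d b = + Tr (b * y) ℤ.- + Tr (b * x)

    d-+ : ∀ b c → d (b + c) ∼ d b ℤ.+ d c
    d-+ b c = ∼-trans (minus-cong-∼ (h y) (h x))
        (∼-reflexive (l (+ Tr (b * y)) (+ Tr (c * y)) (+ Tr (b * x)) (+ Tr (c * x))))
      where
      h : ∀ z → + Tr ((b + c) * z) ∼ + Tr (b * z) ℤ.+ + Tr (c * z)
      h z = ∼-trans (∼-reflexive (cong (+_ ∘ Tr) (distribʳ z b c))) (Tr-+ (b * z) (c * z))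
      l : ∀ a b c d → (a ℤ.+ b) ℤ.- (c ℤ.+ d) ≡ (a ℤ.- c) ℤ.+ (b ℤ.- d)
      l = solve-∀

    d-nontrivial : ∃ λ b → ¬ (d b ∼ + 0)
    d-nontrivial with TrK-nontrivial n≥1 | inverse (y - x) (λ e → x≢y (sym (minus≡0 e)))
    -- b = u / (y - x) turns Tr(b(y - x)) into Tr u, which is nonzero by the choice of u.
    ... | u , Tru≢0 | w , [y-x]w≡1 = u * w , λ e → Tru≢0 (begin
      TrK u                            ≡⟨ sym TrK-difference ⟩
      TrK (u * w * y) - TrK (u * w * x)  ≡⟨ sym (cong₂ _-_ (Tr-correct _) (Tr-correct _)) ⟩
      ιℤ (+ Tr (u * w * y)) - ιℤ (+ Tr (u * w * x))
          ≡⟨ sym (ιℤ-minus (+ Tr (u * w * y)) (+ Tr (u * w * x))) ⟩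
      ιℤ (d (u * w))                   ≡⟨ ιℤ-cong e ⟩
      ιℤ (+ 0)                         ≡⟨ ι-mod 0 ⟩
      0#                               ∎)
      where
      open ≡-Reasoning
      uwy : u * w * y ≡ u + u * w * x
      uwy = begin
        u * w * y                          ≡⟨ cong (u * w *_)
            (sym (trans (+-assoc y (- x) x)
                (trans (cong (λ v → y + v) (-‿inverseˡ x)) (+-identityʳ y)))) ⟩
        u * w * ((y - x) + x)              ≡⟨ distribˡ (u * w) (y - x) x ⟩
        u * w * (y - x) + u * w * x        ≡⟨ cong (_+ u * w * x)
            (trans (*-assoc u w (y - x)) (trans (cong (u *_) (trans (*-comm w (y - x)) [y-x]w≡1))
                (*-identityʳ u))) ⟩
        u + u * w * x                      ∎
      TrK-difference : TrK (u * w * y) - TrK (u * w * x) ≡ TrK u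
      TrK-difference = trans (cong (_- TrK (u * w * x))
            (trans (cong TrK uwy) (TrK-+ u (u * w * x))))
        (trans (+-assoc _ _ _) (trans (cong (λ v → TrK u + v) (-‿inverseʳ _)) (+-identityʳ _)))

    -- The number of b with c + d b divisible by p, that is, the coefficient at -c of Σ ε^(d b).
    G : ℤ → ℤ
    G c = Σℤ.sum (λ b → ind (c ℤ.+ d (element b)))

    G-cong : ∀ {a b} → a ∼ b → G a ≡ G b
    G-cong e = Σℤ.sum-cong-≗ {q} λ b → ind-cong (+-cong-∼ e (∼-refl {d (element b)}))

    G-translate : ∀ b c → G c ≡ G (c ℤ.+ d b)
    G-translate b c = trans
      (Reindex.sum-bijection ℤₚ.+-0-commutativeMonoid (λ z → ind (c ℤ.+ d z)) (_+ b) (_- b)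
        (λ z → trans (+-assoc z _ _) (trans (cong (λ v → z + v) (-‿inverseˡ b)) (+-identityʳ z)))
        (λ z → trans (+-assoc z _ _) (trans (cong (λ v → z + v) (-‿inverseʳ b)) (+-identityʳ z))))
      (Σℤ.sum-cong-≗ {q} λ i → ind-cong
            (∼-trans (+-cong-∼ (∼-refl {c}) (d-+ (element i) b))
              (∼-reflexive (l c (d (element i)) (d b)))))
      where
      l : ∀ a b c → a ℤ.+ (b ℤ.+ c) ≡ a ℤ.+ c ℤ.+ b
      l = solve-∀

    G-translate* : ∀ b k c → G c ≡ G (c ℤ.+ + k ℤ.* d b)
    G-translate* b zero    c = cong G (sym (ℤₚ.+-identityʳ c))
    G-translate* b (suc k) c = trans (G-translate* b k c)
        (trans (G-translate b (c ℤ.+ + k ℤ.* d b))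
          (cong G (trans (l c (+ k) (d b)) (cong (λ w → c ℤ.+ w ℤ.* d b) (sym (ℤₚ.pos-+ 1 k))))))
      where
      l : ∀ c k d → c ℤ.+ k ℤ.* d ℤ.+ d ≡ c ℤ.+ (+ 1 ℤ.+ k) ℤ.* d
      l = solve-∀

    -- Orthogonality: equal coefficients mean that the character sum is 0 in Z[ε_p]. Translating the
    -- summation variable by b moves c by d b; when d b is a unit mod p, repeating this reaches
    -- every residue.
    G-constant : ∀ c c′ → G c ≡ G c′
    G-constant c c′ = from-nontrivial d-nontrivial
      where
      l : ∀ c c′ → c ℤ.+ (c′ ℤ.- c) ℤ.* + 1 ≡ c′
      l = solve-∀
      from-unit : ∀ b → (∃ λ e → e ℤ.* d b ∼ + 1) → G c ≡ G c′
      -- The number of translations is (c′ - c)/(d b) mod p, taken as a natural number.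
      from-unit b (e , e*db∼1) = trans (G-translate* b (toℕ (modp {p} s)) c) (G-cong
        (∼-trans (+-cong-∼ (∼-refl {c}) (∼-trans (*-cong-∼ (modp-∼ s) (∼-refl {d b}))
          (∼-trans (∼-reflexive (ℤₚ.*-assoc (c′ ℤ.- c) e (d b)))
                (*-cong-∼ (∼-refl {c′ ℤ.- c}) e*db∼1))))
          (∼-reflexive (l c c′))))
        where s = (c′ ℤ.- c) ℤ.* e
      from-nontrivial : (∃ λ b → ¬ (d b ∼ + 0)) → G c ≡ G c′
      from-nontrivial (b , db≁0) = from-unit b (unit-mod-p (d b) db≁0)

  phase : (Carrier → Fin p) → Carrier → Fin q → ℤ
  phase f b i = + toℕ (f (element i)) ℤ.- + Tr (b * element i)

  module _ (f : Carrier → Fin p) where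

    -- The coefficient at k of the contribution of the pair (i, j) to the sum of |f̂(b)|² over b.
    H : ℤ → Fin q → Fin q → ℤ
    H k i j = Σℤ.sum (λ b → ind (phase f (element b) i ℤ.- phase f (element b) j ℤ.- k))

    ∑∣f̂∣² : ∀ k → Σℤ.sum (λ b → ∣ fourier K f (element b) ∣² k)
        ≡ Σℤ.sum (λ i → Σℤ.sum (λ j → H (+ toℕ k) i j))
    ∑∣f̂∣² k = trans (Σℤ.sum-cong-≗ {q} λ b → ∣∑ε∣² (phase f (element b)) k)
      (trans (Σℤ.∑-comm {q} {q} λ b i → Σℤ.sum (λ j → t b i j))
            (Σℤ.sum-cong-≗ {q} λ i → Σℤ.∑-comm {q} {q} λ b j → t b i j))
      where
      t : Fin q → Fin q → Fin q → ℤ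
      t b i j = ind (phase f (element b) i ℤ.- phase f (element b) j ℤ.- + toℕ k)

    -- For i = j the phases cancel, so each of the q values of b contributes ε^0: it counts at index
    -- 0 and not at index 1.
    H-diagonal : ∀ i → H (+ toℕ 0F) i i ℤ.- H (+ toℕ 1F) i i ≡ + q
    H-diagonal i = trans (sym (∑-distrib-minus {q} _ _))
        (trans (Σℤ.sum-cong-≗ {q} λ b → cong₂ ℤ._-_ (ind-yes (zero∼ (phase f (element b) i)))
            (ind-no (one≁ (phase f (element b) i)))) (ones q))
      where
      ones : ∀ m → Σℤ.sum {m} (λ _ → + 1) ≡ + m
      ones zero    = refl
      ones (suc m) = trans (cong (ℤ._+_ (+ 1)) (ones m)) (sym (ℤₚ.pos-+ 1 m))
      l : ∀ a k → a ℤ.- a ℤ.- k ≡ ℤ.- k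
      l = solve-∀
      zero∼ : ∀ a → a ℤ.- a ℤ.- + toℕ 0F ∼ + 0
      zero∼ a = ∼-trans (∼-reflexive (l a _)) (neg-cong-∼ (modp-∼ (+ 0)))
      one≁ : ∀ a → ¬ (a ℤ.- a ℤ.- + toℕ 1F ∼ + 0)
      one≁ a e = 1≁0 (∼-trans (∼-sym (modp-∼ (+ 1)))
            (∼-trans (∼-reflexive (sym (trans (cong ℤ.-_ (l a _)) (ℤₚ.neg-involutive _))))
              (neg-cong-∼ e)))

    H-off-diagonal : ∀ k l i j → i ≢ j → H k i j ≡ H l i j
    H-off-diagonal k l i j i≢j = trans (H≡G k)
        (trans (G-constant x y x≢y (offset k) (offset l)) (sym (H≡G l)))
      where
      x = element i
      y = element j
      x≢y : x ≢ y
      x≢y e = i≢j (element-injective e)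
      rearrange : ∀ a s b t k → (a ℤ.- s) ℤ.- (b ℤ.- t) ℤ.- k ≡ (a ℤ.- b ℤ.- k) ℤ.+ (t ℤ.- s)
      rearrange = solve-∀
      offset : ℤ → ℤ
      offset k = + toℕ (f x) ℤ.- + toℕ (f y) ℤ.- k
      H≡G : ∀ k → H k i j ≡ G x y x≢y (offset k)
      H≡G k = Σℤ.sum-cong-≗ {q} λ b → cong ind
          (rearrange (+ toℕ (f x)) (+ Tr (element b * x)) (+ toℕ (f y)) (+ Tr (element b * y)) k)

    -- A vector representing the integer c has coefficients at 0 and 1 that differ by c.
    parseval : Σℤ.sum (λ b → ∣ fourier K f (element b) ∣² 0F ℤ.- ∣ fourier K f (element b) ∣² 1F)
        ≡ + q ℤ.* + q
    parseval = begin
      Σℤ.sum (λ b → ∣ fourier K f (element b) ∣² 0F ℤ.- ∣ fourier K f (element b) ∣² 1F)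
        ≡⟨ ∑-distrib-minus {q} _ _ ⟩
      Σℤ.sum (λ b → ∣ fourier K f (element b) ∣² 0F) ℤ.- Σℤ.sum
          (λ b → ∣ fourier K f (element b) ∣² 1F)
        ≡⟨ cong₂ ℤ._-_ (∑∣f̂∣² 0F) (∑∣f̂∣² 1F) ⟩
      Σℤ.sum (λ i → Σℤ.sum (λ j → H₀ i j)) ℤ.- Σℤ.sum (λ i → Σℤ.sum (λ j → H₁ i j))
        ≡⟨ sym (∑-distrib-minus {q} _ _) ⟩
      Σℤ.sum (λ i → Σℤ.sum (λ j → H₀ i j) ℤ.- Σℤ.sum (λ j → H₁ i j))
        ≡⟨ Σℤ.sum-cong-≗ {q} (λ i → trans (sym (∑-distrib-minus {q} _ _))
              (trans (SumSingle.sum-single ℤₚ.+-0-commutativeMonoid (λ j → H₀ i j ℤ.- H₁ i j) i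
             (λ j j≢i → ℤₚ.i≡j⇒i-j≡0 (H-off-diagonal (+ toℕ 0F) (+ toℕ 1F) i j (j≢i ∘ sym))))
               (H-diagonal i))) ⟩
      Σℤ.sum {q} (λ _ → + q)
        ≡⟨ const-sum q ⟩
      + q ℤ.* + q ∎
      where
      open ≡-Reasoning
      H₀ H₁ : Fin q → Fin q → ℤ
      H₀ = H (+ toℕ 0F)
      H₁ = H (+ toℕ 1F)
      const-sum : ∀ m → Σℤ.sum {m} (λ _ → + q) ≡ + m ℤ.* + q
      const-sum zero    = refl
      const-sum (suc m) = trans (cong (ℤ._+_ (+ q)) (const-sum m))
          (trans (l (+ m) (+ q)) (cong (ℤ._* + q) (sym (ℤₚ.pos-+ 1 m))))
        where
        l : ∀ a b → b ℤ.+ a ℤ.* b ≡ (+ 1 ℤ.+ a) ℤ.* b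
        l = solve-∀

-- Counting the supports, and bentness of F.

∑≤ : ∀ {m} (t : Fin m → ℕ) → (∀ i → t i ℕ.≤ 1) → Σℕ.sum t ℕ.≤ m
∑≤ {zero}  t t≤1 = ℕ.z≤n
∑≤ {suc m} t t≤1 = ℕₚ.+-mono-≤ (t≤1 zero) (∑≤ (t ∘ suc) (t≤1 ∘ suc))

∑≡m⇒≡1 : ∀ {m} (t : Fin m → ℕ) → (∀ i → t i ℕ.≤ 1) → Σℕ.sum t ≡ m → ∀ i → t i ≡ 1
∑≡m⇒≡1 {suc m} t t≤1 e i with t i | t≤1 i | trans (sym (Σℕ.sum-remove {i = i} t)) e
... | zero  | _             | eq = contradiction (ℕₚ.≤-reflexive (sym eq))
    (ℕₚ.<⇒≱ (ℕ.s≤s (∑≤ (t ∘ punchIn i) (t≤1 ∘ punchIn i))))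
... | suc _ | ℕ.s≤s ℕ.z≤n   | _  = refl

module GluedBent {p n : ℕ} .{{_ : NonZero p}} (pr : Prime p) (n≥1 : n ≥ 1) (K : FiniteField p n)
  (f : Fin p → FiniteField.Carrier K → Fin p)
  (near-bent : ∀ i → NearBent K (f i))
  (disjoint : ∀ i j → i ≢ j → ∀ b → ¬ (inSupp K (f i) b × inSupp K (f j) b)) where
  open FiniteField K
  open Cyclotomic p
  open FieldTheory pr K
  open Fourier pr n≥1 K

  P : ℕ
  P = p ℕ.^ suc n

  bit : {A B : Set} → A ⊎ B → ℕ
  bit (inj₁ _) = 0
  bit (inj₂ _) = 1

  -- The indicator of the support of f̂_i, read off the alternative that `near-bent` supplies, so
  -- that no decision procedure for `_≈_` is called for.
  χ : Fin p → Carrier → ℕ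
  χ i b = bit (near-bent i b)

  const-0F-1F : ∀ c → const {p} c 0F ℤ.- const c 1F ≡ c
  const-0F-1F c = trans (cong₂ (λ u v → u ℤ.* c ℤ.- v ℤ.* c) (ind-yes {+ 0} ∼-refl)
        (ind-no {+ 1} 1≁0)) (l c)
    where
    l : ∀ c → + 1 ℤ.* c ℤ.- + 0 ℤ.* c ≡ c
    l = solve-∀

  ∣f̂∣²-difference : ∀ i b → ∣ fourier K (f i) b ∣² 0F ℤ.- ∣ fourier K (f i) b ∣² 1F
      ≡ + χ i b ℤ.* + P
  ∣f̂∣²-difference i b with near-bent i b
  ... | inj₁ e = ≈⇒differences ∣ fourier K (f i) b ∣² zeroC e 0F 1F
  ... | inj₂ e = trans (≈⇒differences ∣ fourier K (f i) b ∣² (const (+ P)) e 0F 1F)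
      (trans (const-0F-1F (+ P)) (sym (ℤₚ.*-identityˡ (+ P))))

  instance
    P≢0 : NonZero P
    P≢0 = ℕₚ.m^n≢0 p (suc n)
    q≢0 : NonZero q
    q≢0 = ℕₚ.m^n≢0 p n

  χ≡1⇒≉0 : ∀ i b → χ i b ≡ 1 → inSupp K (f i) b
  χ≡1⇒≉0 i b χ≡1 f̂≈0 = ℕ.≢-nonZero⁻¹ P
      (ℤₚ.+-injective (trans (sym (trans (∣f̂∣²-difference i b)
              (trans (cong (λ c → + c ℤ.* + P) χ≡1) (ℤₚ.*-identityˡ (+ P)))))
     (≈⇒differences ∣ fourier K (f i) b ∣² zeroC ∣f̂∣²≈0 0F 1F)))
    where
    ∣f̂∣²≈0 : ∣ fourier K (f i) b ∣² ≈ zeroC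
    ∣f̂∣²≈0 = ∣∣²-≈0 (fourier K (f i) b) f̂≈0

  χ≡0⇒≈0 : ∀ i b → χ i b ≡ 0 → fourier K (f i) b ≈ zeroC
  χ≡0⇒≈0 i b χ≡0 with near-bent i b
  ... | inj₁ e = ∣∣²≈0⇒≈0 (fourier K (f i) b) e

  χ-cases : ∀ i b → χ i b ≡ 0 ⊎ χ i b ≡ 1
  χ-cases i b with near-bent i b
  ... | inj₁ _ = inj₁ refl
  ... | inj₂ _ = inj₂ refl

  -- Parseval gives N p^(n+1) = q² for the size N of the support. Since p^(n+1) = p q, one factor q
  -- cancels; the form N p = q avoids the exponent n - 1.
  support-size : ∀ i → Σℕ.sum (λ b → χ i (element b)) ℕ.* p ≡ q
  support-size i = ℕₚ.*-cancelʳ-≡ _ q q (trans (ℕₚ.*-assoc N p q) (ℤₚ.+-injective (begin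
    + (N ℕ.* P)                                              ≡⟨ ℤₚ.pos-* N P ⟩
    + N ℤ.* + P                                              ≡⟨ cong (ℤ._* + P)
        (sym (pos-sum (λ b → χ i (element b)))) ⟩
    Σℤ.sum (λ b → + χ i (element b)) ℤ.* + P                 ≡⟨ ℤSum.*-distribʳ-sum (+ P)
        (λ b → + χ i (element b)) ⟩
    Σℤ.sum (λ b → + χ i (element b) ℤ.* + P)                 ≡⟨ Σℤ.sum-cong-≗ {q}
        (λ b → sym (∣f̂∣²-difference i (element b))) ⟩
    Σℤ.sum (λ b → ∣ fourier K (f i) (element b) ∣² 0F ℤ.- ∣ fourier K (f i) (element b) ∣² 1F)
        ≡⟨ parseval (f i) ⟩
    + q ℤ.* + q                                              ≡⟨ sym (ℤₚ.pos-* q q) ⟩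
    + (q ℕ.* q)                                              ∎)))
    where
    open ≡-Reasoning
    N = Σℕ.sum (λ b → χ i (element b))
    pos-sum : ∀ {m} (t : Fin m → ℕ) → Σℤ.sum (λ b → + t b) ≡ + Σℕ.sum t
    pos-sum {zero}  t = refl
    pos-sum {suc m} t = trans (cong (ℤ._+_ (+ t zero)) (pos-sum (t ∘ suc)))
        (sym (ℤₚ.pos-+ (t zero) _))

  unique : ∀ i b → χ i b ≡ 1 → ∀ j → j ≢ i → χ j b ≡ 0
  unique i b χi≡1 j j≢i with χ-cases j b
  ... | inj₁ e = e
  ... | inj₂ e = contradiction (χ≡1⇒≉0 j b e , χ≡1⇒≉0 i b χi≡1) (disjoint j i j≢i b)

  multiplicity : ∀ b → (∃ λ i → χ i b ≡ 1) ⊎ (Σℕ.sum (λ i → χ i b) ≡ 0)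
  multiplicity b with Finₚ.any? (λ i → χ i b ℕ.≟ 1)
  ... | yes found = inj₁ found
  ... | no none   = inj₂ (SumSingle.sum-zero ℕₚ.+-0-commutativeMonoid (λ i → χ i b) λ i → [
        (λ e → e) , (λ e → contradiction (i , e) none) ]′ (χ-cases i b))

  multiplicity≤1 : ∀ b → Σℕ.sum (λ i → χ i b) ℕ.≤ 1
  multiplicity≤1 b with multiplicity b
  ... | inj₁ (i , e) = ℕₚ.≤-reflexive
      (trans (SumSingle.sum-single ℕₚ.+-0-commutativeMonoid (λ i → χ i b) i (unique i b e)) e)
  ... | inj₂ e = ℕₚ.≤-trans (ℕₚ.≤-reflexive e) ℕ.z≤n

  -- The p disjoint supports have p^(n-1) elements each, so they cover K.
  ∑multiplicity : Σℕ.sum (λ b → Σℕ.sum (λ i → χ i (element b))) ≡ q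
  ∑multiplicity = trans (Σℕ.∑-comm {q} {p} λ b i → χ i (element b)) (ℕₚ.*-cancelʳ-≡ _ q p (begin
    Σℕ.sum N ℕ.* p                ≡⟨ ℕSum.*-distribʳ-sum p N ⟩
    Σℕ.sum (λ i → N i ℕ.* p)      ≡⟨ Σℕ.sum-cong-≗ {p} support-size ⟩
    Σℕ.sum {p} (λ _ → q)          ≡⟨ const-sum p ⟩
    p ℕ.* q                       ≡⟨ ℕₚ.*-comm p q ⟩
    q ℕ.* p                       ∎))
    where
    open ≡-Reasoning
    N : Fin p → ℕ
    N i = Σℕ.sum (λ b → χ i (element b))
    const-sum : ∀ m → Σℕ.sum {m} (λ _ → q) ≡ m ℕ.* q
    const-sum zero    = refl
    const-sum (suc m) = cong (q ℕ.+_) (const-sum m)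

  -- The q multiplicities are at most 1 and add up to q, so none of them is 0.
  covered : ∀ a → ∃ λ i → χ i a ≡ 1
  covered a with multiplicity a
  ... | inj₁ found = found
  ... | inj₂ e = contradiction (trans (sym e)
        (subst (λ a → Σℕ.sum (λ i → χ i a) ≡ 1) (element-index a)
        (∑≡m⇒≡1 (λ b → Σℕ.sum (λ i → χ i (element b)))
              (λ b → multiplicity≤1 (element b)) ∑multiplicity (index a)))) λ ()

  -- Multiplication by ε^(-by) shows up as a shift of the coefficient index by b y.
  fourier₂≡∑ : ∀ a b c → fourier₂ K (gluedF K f) a b ⟨ c ⟩
      ≡ Σℤ.sum {p} (λ y → fourier K (f y) a ⟨ c ℤ.+ + toℕ b ℤ.* + toℕ y ⟩)
  fourier₂≡∑ a b c = begin
    fourier₂ K (gluedF K f) a b ⟨ c ⟩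
      ≡⟨ trans (sumFin≡sum q _ (modp c)) (Σℤ.sum-cong-≗ {q} λ x → ∑ε⟨⟩ {p} (e x) c) ⟩
    Σℤ.sum {q} (λ x → Σℤ.sum {p} (λ y → ind (c ℤ.- e x y)))
      ≡⟨ Σℤ.∑-comm {q} {p} (λ x y → ind (c ℤ.- e x y)) ⟩
    Σℤ.sum {p} (λ y → Σℤ.sum {q} (λ x → ind (c ℤ.- e x y)))
      ≡⟨ Σℤ.sum-cong-≗ {p} (λ y → Σℤ.sum-cong-≗ {q} λ x → cong ind
            (trans (cong (λ v → c ℤ.- (+ toℕ v ℤ.- + Tr (a * element x) ℤ.- + toℕ b ℤ.* + toℕ y))
                (Gluing.gluedF≡ pr K f (element x) y))
            (l c (+ toℕ (f y (element x))) (+ Tr (a * element x)) (+ toℕ b ℤ.* + toℕ y)))) ⟩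
    Σℤ.sum {p} (λ y → Σℤ.sum {q} (λ x → ind ((c ℤ.+ + toℕ b ℤ.* + toℕ y) ℤ.- phase (f y) a x)))
      ≡⟨ Σℤ.sum-cong-≗ {p} (λ y → sym (∑ε⟨⟩ (phase (f y) a) (c ℤ.+ + toℕ b ℤ.* + toℕ y))) ⟩
    Σℤ.sum {p} (λ y → fourier K (f y) a ⟨ c ℤ.+ + toℕ b ℤ.* + toℕ y ⟩) ∎
    where
    open ≡-Reasoning
    e : Fin q → Fin p → ℤ
    e x y = + toℕ (gluedF K f (element x) y) ℤ.- + Tr (a * element x) ℤ.- + toℕ b ℤ.* + toℕ y
    l : ∀ c u t s → c ℤ.- (u ℤ.- t ℤ.- s) ≡ (c ℤ.+ s) ℤ.- (u ℤ.- t)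
    l = solve-∀

  bent : Bent K (gluedF K f)
  bent a b = from-cover (covered a)
    where
    from-cover : (∃ λ i → χ i a ≡ 1) → ∣ fourier₂ K (gluedF K f) a b ∣² ≈ const (+ P)
    from-cover (i , χ≡1) = ≈-trans ∣ w ∣² ∣ z ∣² (const (+ P)) (∣∣²-shift z w s shifted)
        (bent-at i χ≡1)
      where
      w = fourier₂ K (gluedF K f) a b
      z = fourier K (f i) a
      s = + toℕ b ℤ.* + toℕ i
      bent-at : ∀ i → χ i a ≡ 1 → ∣ fourier K (f i) a ∣² ≈ const (+ P)
      bent-at i e with near-bent i a
      ... | inj₂ bent = bent
      t : ℤ → Fin p → ℤ
      t c y = fourier K (f y) a ⟨ c ℤ.+ + toℕ b ℤ.* + toℕ y ⟩
      -- The summands with y ≠ i are known only to be constant vectors, so they drop out of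
      -- differences of coefficients rather than of the coefficients themselves.
      shifted : ∀ c d → w ⟨ c ⟩ ℤ.- w ⟨ d ⟩ ≡ z ⟨ c ℤ.+ s ⟩ ℤ.- z ⟨ d ℤ.+ s ⟩
      shifted c d = trans (cong₂ ℤ._-_ (fourier₂≡∑ a b c) (fourier₂≡∑ a b d))
          (trans (sym (∑-distrib-minus {p} (t c) (t d)))
        (SumSingle.sum-single ℤₚ.+-0-commutativeMonoid (λ y → t c y ℤ.- t d y) i λ y y≢i →
              ≈⇒differences (fourier K (f y) a) zeroC (χ≡0⇒≈0 y a (unique i a χ≡1 y y≢i)) _ _))

theorem1 : (p n : ℕ) .{{_ : NonZero p}} → Prime p → n ≥ 1 →
    (K : FiniteField p n) →
    (f : Fin p → FiniteField.Carrier K → Fin p) →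
    (∀ i → NearBent K (f i)) →
    (∀ i j → i ≢ j → ∀ b → ¬ (inSupp K (f i) b × inSupp K (f j) b)) →
    Bent K (gluedF K f)
theorem1 p n pr n≥1 K f near-bent disjoint = GluedBent.bent pr n≥1 K f near-bent disjoint
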